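{- Every right pseudogalaxy satisfies the Erdős–Hajnal Conjecture: for every right pseudogalaxy $H$ there exists $\epsilon(H)>0$ such that every tournament $T$ not containing $H$ as a subtournament contains a transitive subtournament on at least $|T|^{\epsilon(H)}$ vertices.
   Context: Tournaments are finite; subtournament = induced subtournament; transitive = no directed cycle. Given an ordering of the vertex set of a tournament, an edge $(x,y)$ is backward if $y$ precedes $x$; a tournament with an ordered vertex set is determined by its set of backward edges. For a tournament $T$ and ordering $\theta=(v_1,\dots,v_n)$ of $V(T)$, $B(T,\theta)$ is the undirected graph on $V(T)$ in which $v_iv_j$ is an edge iff the edge between $v_i,v_j$ is backward. A right star is an induced subgraph of $B(T,\theta)$ on $\{v_{i_0},\dots,v_{i_t}\}$ which is a star $K_{1,t}$ with center $v_{i_t}$ and $i_t>i_0,\dots,i_{t-1}$; a left star is one that is a star with center $v_{i_0}$ and $i_0<i_1,\dots,i_t$ (for $t=1$ either vertex may be regarded as the center). $T$ is a galaxy if some ordering $\theta$ (a galaxy ordering) has every connected component of $B(T,\theta)$ a left star, a right star, or a singleton, and no center of a star lies in the ordering between two leaves of another star; the non-singleton components are the stars of $T$. Product: for tournaments $H_1,H_2$ with disjoint vertex sets and injective $f_1:V(H_1)\to\mathbb{N}$, $f_2:V(H_2)\to\mathbb{N}$ with disjoint images, let $\theta_i$ order $V(H_i)$ by increasing $f_i$ and $\theta$ order $V(H_1)\cup V(H_2)$ by increasing value of $f_1$ on $V(H_1)$ and $f_2$ on $V(H_2)$; $H_1^{f_1}\oplus H_2^{f_2}$ is the tournament on $V(H_1)\cup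 V(H_2)$ whose backward edges under $\theta$ are exactly those of $H_1$ under $\theta_1$ together with those of $H_2$ under $\theta_2$. Right pseudogalaxy: let $H_l$ have vertices $h_1,\dots,h_7$ and backward edges under $(h_1,\dots,h_7)$ exactly $(h_4,h_1),(h_6,h_2),(h_6,h_1),(h_5,h_3),(h_7,h_5)$. Let $G$ be a galaxy with galaxy ordering $(g_1,\dots,g_r)$ and let $1\le s\le r$ be such that no star of $G$ has one leaf in $\{g_1,\dots,g_s\}$ and another leaf in $\{g_{s+1},\dots,g_r\}$. Let $\rho_1(h_i)=i$ for $i=1,\dots,6$, $\rho_1(h_7)=7+s$; $\rho_2(g_u)=6+u$ for $u\le s$ and $\rho_2(g_u)=7+u$ for $u>s$. Then $H=H_l^{\rho_1}\oplus G^{\rho_2}$ is a right pseudogalaxy. -}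

module Defs where

open import Data.Nat using (ℕ; zero; suc; _+_; _<_; _≤_; _^_)
open import Data.Fin using (Fin; toℕ; inject₁; fromℕ)
import Data.Fin as F
open import Data.Sum using (_⊎_; inj₁; inj₂)
open import Data.Product using (Σ; ∃; ∃-syntax; _×_; _,_)
open import Data.Empty using (⊥)
open import Relation.Nullary using (¬_)
open import Relation.Nullary.Decidable using (does)
open import Relation.Binary.PropositionalEquality using (_≡_; _≢_)
open import Function.Definitions using (Injective)
open import Function.Bundles using (_⇔_)
open import Data.Bool using (if_then_else_)

IsTournament : {V : Set} → (V → V → Set) → Set
IsTournament {V} adj =
  (∀ x → ¬ adj x x) ×
  (∀ x y → x ≢ y → adj x y ⊎ adj y x) ×
  (∀ x y → adj x y → adj y x → ⊥)

Contains : {V W : Set} → (V → V → Set) → (W → W → Set) → Set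
Contains {V} {W} adjT adjH =
  Σ (W → V) λ f → Injective _≡_ _≡_ f ×
    (∀ x y → adjT (f x) (f y) ⇔ adjH x y)

DirectedCycle : {V : Set} → (V → V → Set) → Set
DirectedCycle {V} adj =
  Σ ℕ λ m → Σ (Fin (suc m) → V) λ w → Injective _≡_ _≡_ w ×
    (∀ (i : Fin m) → adj (w (inject₁ i)) (w (F.suc i))) ×
    adj (w (fromℕ m)) (w F.zero)

IsTransitive : {V : Set} → (V → V → Set) → Set
IsTransitive adj = ¬ DirectedCycle adj

HasTransitiveSub : {n : ℕ} → (Fin n → Fin n → Set) → ℕ → Set
HasTransitiveSub {n} adj k =
  Σ (Fin k → Fin n) λ f → Injective _≡_ _≡_ f ×
    IsTransitive (λ i j → adj (f i) (f j))

-- Ordered tournaments on Fin r (ordering = natural order of Fin r)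

Backward : {r : ℕ} → (Fin r → Fin r → Set) → Fin r → Fin r → Set
Backward adj x y = adj x y × y F.< x

BEdge : {r : ℕ} → (Fin r → Fin r → Set) → Fin r → Fin r → Set
BEdge adj x y = Backward adj x y ⊎ Backward adj y x

data Conn {r : ℕ} (adj : Fin r → Fin r → Set) : Fin r → Fin r → Set where
  here : ∀ {x} → Conn adj x x
  step : ∀ {x y z} → BEdge adj x y → Conn adj y z → Conn adj x z

-- Galaxy-ordering data for the natural order of Fin r: a choice of a
-- centre for every component, such that every component is a singleton,
-- a left star or a right star (with the chosen centre), and no centre of a
-- star lies between two leaves of another star.
record GalaxyOrdering {r : ℕ} (adj : Fin r → Fin r → Set) : Set where
  field
    cen        : Fin r → Fin r
    cen-comp   : ∀ v → Conn adj v (cen v)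
    cen-const  : ∀ u v → Conn adj u v → cen u ≡ cen v
    components : ∀ v →
      (∀ u → ¬ BEdge adj v u) ⊎
      ((∀ u w → Conn adj v u → Conn adj v w →
          BEdge adj u w ⇔ (u ≢ w × (u ≡ cen v ⊎ w ≡ cen v))) ×
       ((∀ u → Conn adj v u → u F.≤ cen v)      -- right star
        ⊎ (∀ u → Conn adj v u → cen v F.≤ u)))  -- left star
    noncrossing : ∀ v l₁ l₂ →
      (Σ (Fin r) λ u → BEdge adj v u) →
      ¬ Conn adj v l₁ →
      Conn adj l₁ l₂ → l₁ ≢ cen l₁ → l₂ ≢ cen l₁ →
      ¬ (l₁ F.< cen v × cen v F.< l₂)

-- T (on Fin r, natural order) is a galaxy and the natural order is a galaxy ordering
-- (witnessed by the given data); leaves are vertices not equal to the centre.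
-- Split condition: no star has one leaf among the first s vertices and
-- another among the remaining ones.
SplitOK : {r : ℕ} {adj : Fin r → Fin r → Set} → GalaxyOrdering adj → ℕ → Set
SplitOK {r} {adj} g s =
  ∀ l₁ l₂ → Conn adj l₁ l₂ →
    l₁ ≢ GalaxyOrdering.cen g l₁ → l₂ ≢ GalaxyOrdering.cen g l₁ →
    toℕ l₁ < s → s ≤ toℕ l₂ → ⊥

pos : {V₁ V₂ : Set} → (V₁ → ℕ) → (V₂ → ℕ) → V₁ ⊎ V₂ → ℕ
pos f₁ f₂ (inj₁ x) = f₁ x
pos f₁ f₂ (inj₂ x) = f₂ x

ProdBackward : {V₁ V₂ : Set} → (V₁ → V₁ → Set) → (V₁ → ℕ) →
               (V₂ → V₂ → Set) → (V₂ → ℕ) → V₁ ⊎ V₂ → V₁ ⊎ V₂ → Set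
ProdBackward a₁ f₁ a₂ f₂ (inj₁ x) (inj₁ y) = a₁ x y × f₁ y < f₁ x
ProdBackward a₁ f₁ a₂ f₂ (inj₂ x) (inj₂ y) = a₂ x y × f₂ y < f₂ x
ProdBackward a₁ f₁ a₂ f₂ _ _ = ⊥

Prod : {V₁ V₂ : Set} → (V₁ → V₁ → Set) → (V₁ → ℕ) →
       (V₂ → V₂ → Set) → (V₂ → ℕ) → V₁ ⊎ V₂ → V₁ ⊎ V₂ → Set
Prod a₁ f₁ a₂ f₂ x y =
  (pos f₁ f₂ x < pos f₁ f₂ y × ¬ ProdBackward a₁ f₁ a₂ f₂ y x) ⊎
  (pos f₁ f₂ y < pos f₁ f₂ x × ProdBackward a₁ f₁ a₂ f₂ x y)

-- H_l on Fin 7: vertex i (0-based) is h_{i+1}; ordered by (h₁,…,h₇).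
-- Backward edges (h₄,h₁),(h₆,h₂),(h₆,h₁),(h₅,h₃),(h₇,h₅).

data HlBack : Fin 7 → Fin 7 → Set where
  e41 : HlBack (F.suc (F.suc (F.suc F.zero))) F.zero
  e62 : HlBack (F.suc (F.suc (F.suc (F.suc (F.suc F.zero))))) (F.suc F.zero)
  e61 : HlBack (F.suc (F.suc (F.suc (F.suc (F.suc F.zero))))) F.zero
  e53 : HlBack (F.suc (F.suc (F.suc (F.suc F.zero)))) (F.suc (F.suc F.zero))
  e75 : HlBack (F.suc (F.suc (F.suc (F.suc (F.suc (F.suc F.zero))))))
               (F.suc (F.suc (F.suc (F.suc F.zero))))

Hl : Fin 7 → Fin 7 → Set
Hl x y = (x F.< y × ¬ HlBack y x) ⊎ (y F.< x × HlBack x y)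

-- ρ₁(h_i) = i (i ≤ 6), ρ₁(h₇) = 7 + s   (0-based index i ↦ h_{i+1})
ρ₁ : ℕ → Fin 7 → ℕ
ρ₁ s i = if does (toℕ i Data.Nat.≟ 6) then 7 + s else suc (toℕ i)

-- ρ₂(g_u) = 6 + u (u ≤ s), 7 + u (u > s)   (0-based index u ↦ g_{u+1})
ρ₂ : {r : ℕ} → ℕ → Fin r → ℕ
ρ₂ s u = if does (suc (toℕ u) Data.Nat.≤? s) then 7 + toℕ u else 8 + toℕ u

RightPseudogalaxy : {r : ℕ} → (Fin r → Fin r → Set) → ℕ →
                    Fin 7 ⊎ Fin r → Fin 7 ⊎ Fin r → Set
RightPseudogalaxy adjG s = Prod Hl (ρ₁ s) adjG (ρ₂ s)

{-# OPTIONS --safe #-}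

-- In a minimal counterexample with exponent 1/q, q large, no large set is complete to another large set, nor to or from
-- a transitive set of size comparable with the maximum.  A tournament without H has two large sets with few edges in one
-- direction; iterating this gives a long sequence of blocks, alternately large and transitive sets, in which back edges
-- are rare.  By minimality they nevertheless exist between any sizeable subsets of two blocks not both transitive.
-- Hence stars of back edges with a large centre block are found one after the other, always inside the vertices joined
-- by forward edges to everything chosen before, and this embeds G.  For H_l, choose a back path h₄ h₁ h₆ h₂ with h₂ and
-- h₄ in one transitive block, and a back path h₃ h₅ h₇.  If both are induced, they form H_l.  Otherwise three blocks
-- contain a triangle of back edges; but in the order h₂ h₄ h₁ h₅ h₃ h₆ h₇ the back edges of H_l form the triangle
-- h₁ h₂ h₆ together with two disjoint edges h₃ h₄ and h₅ h₇, so H_l is found again.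
module Submission where

open import Defs
open import Data.Bool using (Bool; true; false; not; _∧_; _∨_; T; if_then_else_)
open import Data.Bool.ListAction using (any)
open import Data.Empty using (⊥; ⊥-elim)
open import Data.Fin using (Fin; zero; suc; toℕ; fromℕ; fromℕ<; inject₁; splitAt; join)
import Data.Fin as F
open import Data.Fin.Patterns
import Data.Fin.Properties as Fin
open import Data.List using (List; []; _∷_; _++_; length; map; filterᵇ; take; drop; upTo; cartesianProduct; allFin; tabulate; lookup)
open import Data.List.Membership.Propositional using (_∈_; find; lose)
open import Data.List.Membership.Propositional.Properties
  using (∈-map⁺; ∈-map⁻; ∈-cartesianProduct⁺; ∈-cartesianProduct⁻; ∈-upTo⁺; ∈-upTo⁻; ∈-allFin; ∈-tabulate⁺; ∈-++⁺ʳ; ∈-++⁻)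
open import Data.List.Properties
  using (length-take; length-drop; length-map; length-upTo; length-++; length-tabulate; drop-drop; tabulate-lookup)
open import Data.List.Relation.Unary.All as All using (All; []; _∷_)
import Data.List.Relation.Unary.All.Properties as All
open import Data.List.Relation.Unary.AllPairs as AllPairs using (AllPairs; []; _∷_)
import Data.List.Relation.Unary.AllPairs.Properties as AllPairs
open import Data.List.Relation.Unary.Any as Any using (Any; here; there)
open import Data.List.Relation.Unary.Unique.Propositional using (Unique)
import Data.List.Relation.Unary.Unique.Propositional.Properties as Unique
open import Data.Nat
open import Data.Nat.DivMod using (_/_; _%_; m/n*n≤m; m≡m%n+[m/n]*n; m%n<n)
open import Data.Nat.Induction using (<-rec)
open import Data.Nat.ListAction using (sum)
open import Data.Nat.Properties
open import Data.Nat.Tactic.RingSolver using (solve-∀)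
open import Data.Product using (Σ; ∃; _×_; _,_; proj₁; proj₂)
open import Data.Sum using (_⊎_; inj₁; inj₂; [_,_]′)
open import Function using (_∘_)
open import Function.Bundles using (_⇔_; mk⇔; Equivalence)
open import Function.Definitions using (Injective)
open import Relation.Binary using (tri<; tri≈; tri>)
open import Relation.Binary.PropositionalEquality
open import Relation.Nullary using (¬_; Dec; yes; no; does)
open import Relation.Nullary.Decidable using (map′; _×-dec_; _⊎-dec_; ¬?; dec-true; dec-false)

-- Counting

-- `dense` supplies one star of back edges at a time, and says nothing about the edges among
-- vertices found together. Leaves in one transitive block are the exception: their edges are
-- forward. This is the use of `SplitOK` and `noncrossing`, which let all leaves of a star share a
-- block. In H_l three pairs stay uncontrolled, h₁h₂, h₄h₆ and h₃h₇; each of them, if it points the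
-- wrong way, closes a triangle of back edges. The transitive sets at hand have order only
-- |X|^(1/q), so an edge count between linear-sized sets says nothing about them. Sparsity is
-- therefore carried as a bound for every single vertex, which passes to arbitrary subsets. The
-- choice of constants is not circular: M, N, E, D depend on r alone, they fix the loss factor C =
-- `spread`, and q = C * C comes last, so that (1 - 1/C)^q ≤ 1/C. All densities are written by
-- multiplication: a fraction at least 1/D of m is m ≤ D * x.

# : {A : Set} → (A → Bool) → List A → ℕ
# p xs = length (filterᵇ p xs)

⟦_⟧ : Bool → ℕ
⟦ true ⟧ = 1
⟦ false ⟧ = 0

#-∷ : {A : Set} (p : A → Bool) (x : A) (xs : List A) → # p (x ∷ xs) ≡ ⟦ p x ⟧ + # p xs
#-∷ p x xs with p x
... | true = refl
... | false = refl

∈-filterᵇ⁻ : {A : Set} (p : A → Bool) {x : A} (xs : List A) → x ∈ filterᵇ p xs → x ∈ xs × p x ≡ true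
∈-filterᵇ⁻ p (y ∷ xs) h with p y in eq
∈-filterᵇ⁻ p (y ∷ xs) (here refl) | true = here refl , eq
∈-filterᵇ⁻ p (y ∷ xs) (there h) | true = let a , b = ∈-filterᵇ⁻ p xs h in there a , b
∈-filterᵇ⁻ p (y ∷ xs) h | false = let a , b = ∈-filterᵇ⁻ p xs h in there a , b

∈-filterᵇ⁺ : {A : Set} (p : A → Bool) {x : A} (xs : List A) → x ∈ xs → p x ≡ true → x ∈ filterᵇ p xs
∈-filterᵇ⁺ p (y ∷ xs) (here refl) e rewrite e = here refl
∈-filterᵇ⁺ p (y ∷ xs) (there h) e with p y
... | true = there (∈-filterᵇ⁺ p xs h e)
... | false = ∈-filterᵇ⁺ p xs h e

All-filterᵇ : {A : Set} {P : A → Set} (p : A → Bool) {xs : List A} → All P xs → All P (filterᵇ p xs)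
All-filterᵇ p [] = []
All-filterᵇ p {x ∷ xs} (a ∷ as) with p x
... | true = a ∷ All-filterᵇ p as
... | false = All-filterᵇ p as

AllPairs-filterᵇ : {A : Set} {R : A → A → Set} (p : A → Bool) {xs : List A} → AllPairs R xs → AllPairs R (filterᵇ p xs)
AllPairs-filterᵇ p [] = []
AllPairs-filterᵇ p {x ∷ xs} (a ∷ as) with p x
... | true = All-filterᵇ p a ∷ AllPairs-filterᵇ p as
... | false = AllPairs-filterᵇ p as

#-compl : {A : Set} (p : A → Bool) (xs : List A) → # p xs + # (not ∘ p) xs ≡ length xs
#-compl p [] = refl
#-compl p (x ∷ xs) with p x
... | true = cong suc (#-compl p xs)
... | false = trans (+-suc _ _) (cong suc (#-compl p xs))

#-split : {A : Set} (p q : A → Bool) (xs : List A) → # p xs ≡ # (λ x → p x ∧ q x) xs + # (λ x → p x ∧ not (q x)) xs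
#-split p q [] = refl
#-split p q (x ∷ xs) with p x | q x
... | true | true = cong suc (#-split p q xs)
... | true | false = trans (cong suc (#-split p q xs)) (sym (+-suc _ _))
... | false | _ = #-split p q xs

#-∨ : {A : Set} (p q : A → Bool) (xs : List A) → # (λ x → p x ∨ q x) xs ≤ # p xs + # q xs
#-∨ p q [] = z≤n
#-∨ p q (x ∷ xs) with p x | q x
... | true | true = s≤s (≤-trans (#-∨ p q xs) (+-monoʳ-≤ _ (n≤1+n _)))
... | true | false = s≤s (#-∨ p q xs)
... | false | true = ≤-trans (s≤s (#-∨ p q xs)) (≤-reflexive (sym (+-suc _ _)))
... | false | false = #-∨ p q xs

#-filter-≤ : {A : Set} (p q : A → Bool) (xs : List A) → # p (filterᵇ q xs) ≤ # p xs
#-filter-≤ p q [] = z≤n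
#-filter-≤ p q (x ∷ xs) with q x
... | false = ≤-trans (#-filter-≤ p q xs) (≤-trans (m≤n+m _ ⟦ p x ⟧) (≤-reflexive (sym (#-∷ p x xs))))
... | true = ≤-trans (≤-reflexive (#-∷ p x (filterᵇ q xs))) (≤-trans (+-monoʳ-≤ ⟦ p x ⟧ (#-filter-≤ p q xs)) (≤-reflexive (sym (#-∷ p x xs))))

#-≤-length : {A : Set} (p : A → Bool) (xs : List A) → # p xs ≤ length xs
#-≤-length p xs = ≤-trans (m≤m+n _ _) (≤-reflexive (#-compl p xs))

#-cong : {A : Set} {p q : A → Bool} (xs : List A) → (∀ x → x ∈ xs → p x ≡ q x) → # p xs ≡ # q xs
#-cong [] h = refl
#-cong {p = p} {q} (x ∷ xs) h = trans (#-∷ p x xs) (trans (cong₂ _+_ (cong ⟦_⟧ (h x (here refl))) (#-cong xs (λ y m → h y (there m)))) (sym (#-∷ q x xs)))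

#-false : {A : Set} (xs : List A) → # (λ _ → false) xs ≡ 0
#-false [] = refl
#-false (x ∷ xs) = #-false xs

#-true : {A : Set} (xs : List A) → # (λ _ → true) xs ≡ length xs
#-true [] = refl
#-true (x ∷ xs) = cong suc (#-true xs)

nonempty : {A : Set} (xs : List A) → 1 ≤ length xs → ∃ λ x → x ∈ xs
nonempty (x ∷ xs) _ = x , here refl

#-witness : {A : Set} (p : A → Bool) (xs : List A) → 1 ≤ # p xs → ∃ λ x → x ∈ xs × p x ≡ true
#-witness p xs h = let x , m = nonempty _ h ; a , b = ∈-filterᵇ⁻ p xs m in x , a , b

∑ : {A : Set} → List A → (A → ℕ) → ℕ
∑ xs f = sum (map f xs)

∑-zero : {A : Set} (xs : List A) → ∑ xs (λ _ → 0) ≡ 0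
∑-zero [] = refl
∑-zero (x ∷ xs) = ∑-zero xs

∑-+ : {A : Set} (xs : List A) (f g : A → ℕ) → ∑ xs (λ x → f x + g x) ≡ ∑ xs f + ∑ xs g
∑-+ [] f g = refl
∑-+ (x ∷ xs) f g rewrite ∑-+ xs f g = interchange (f x) (g x) (∑ xs f) (∑ xs g)
  where
  interchange : ∀ a b c d → a + b + (c + d) ≡ a + c + (b + d)
  interchange = solve-∀

∑-cong : {A : Set} (xs : List A) {f g : A → ℕ} → (∀ x → f x ≡ g x) → ∑ xs f ≡ ∑ xs g
∑-cong [] h = refl
∑-cong (x ∷ xs) h = cong₂ _+_ (h x) (∑-cong xs h)

∑-mono : {A : Set} (xs : List A) {f g : A → ℕ} → (∀ x → x ∈ xs → f x ≤ g x) → ∑ xs f ≤ ∑ xs g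
∑-mono [] h = z≤n
∑-mono (x ∷ xs) h = +-mono-≤ (h x (here refl)) (∑-mono xs (λ y m → h y (there m)))

∑-*ˡ : {A : Set} (k : ℕ) (xs : List A) (f : A → ℕ) → ∑ xs (λ x → k * f x) ≡ k * ∑ xs f
∑-*ˡ k [] f = sym (*-zeroʳ k)
∑-*ˡ k (x ∷ xs) f = trans (cong (k * f x +_) (∑-*ˡ k xs f)) (sym (*-distribˡ-+ k (f x) (∑ xs f)))

∑-const : {A : Set} (k : ℕ) (xs : List A) → ∑ xs (λ _ → k) ≡ length xs * k
∑-const k [] = refl
∑-const k (x ∷ xs) = cong (k +_) (∑-const k xs)

∑-bound : {A : Set} (k t : ℕ) (xs : List A) {f : A → ℕ} → (∀ x → x ∈ xs → k * f x ≤ t) → k * ∑ xs f ≤ length xs * t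
∑-bound k t xs {f} h = ≤-trans (≤-reflexive (sym (∑-*ˡ k xs f))) (≤-trans (∑-mono xs h) (≤-reflexive (∑-const t xs)))

∑-swap : {A B : Set} (R : A → B → Bool) (xs : List A) (ys : List B) →
  ∑ xs (λ x → # (R x) ys) ≡ ∑ ys (λ y → # (λ x → R x y) xs)
∑-swap R [] ys = sym (∑-zero ys)
∑-swap {A} {B} R (x ∷ xs) ys = begin
  # (R x) ys + ∑ xs (λ x → # (R x) ys)                    ≡⟨ cong₂ _+_ (#-∑ ys) (∑-swap R xs ys) ⟩
  ∑ ys (λ y → ⟦ R x y ⟧) + ∑ ys (λ y → # (λ x → R x y) xs) ≡⟨ sym (∑-+ ys _ _) ⟩
  ∑ ys (λ y → ⟦ R x y ⟧ + # (λ x → R x y) xs)             ≡⟨ ∑-cong ys (λ y → sym (#-∷ (λ x → R x y) x xs)) ⟩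
  ∑ ys (λ y → # (λ x → R x y) (x ∷ xs))                    ∎
  where
  open ≡-Reasoning
  #-∑ : (zs : List B) → # (R x) zs ≡ ∑ zs (λ y → ⟦ R x y ⟧)
  #-∑ [] = refl
  #-∑ (z ∷ zs) = trans (#-∷ (R x) z zs) (cong (⟦ R x z ⟧ +_) (#-∑ zs))

<ᵇ-true : ∀ {i j} → i < j → (i <ᵇ j) ≡ true
<ᵇ-true {i} {j} l with i <ᵇ j in eq
... | true = refl
... | false = ⊥-elim (subst T eq (<⇒<ᵇ l))

⊥-true : {b : Bool} → b ≡ true → b ≡ false → ⊥
⊥-true refl ()

-- K * f x ≤ t, negated, is the division-free form of the threshold f x > t / K in Markov's inequality.
heavy : {A : Set} (K t : ℕ) (f : A → ℕ) → A → Bool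
heavy K t f x = not (K * f x ≤ᵇ t)

heavy-false : {A : Set} (K t : ℕ) (f : A → ℕ) (x : A) → heavy K t f x ≡ false → K * f x ≤ t
heavy-false K t f x h with K * f x ≤ᵇ t in eq
... | true = ≤ᵇ⇒≤ (K * f x) t (subst T (sym eq) _)

markov-count : {A : Set} (K t : ℕ) (f : A → ℕ) (xs : List A) → # (heavy K t f) xs * t ≤ K * ∑ xs f
markov-count K t f [] = z≤n
markov-count K t f (x ∷ xs) rewrite *-distribˡ-+ K (f x) (∑ xs f) with K * f x ≤ᵇ t in eq
... | true = ≤-trans (markov-count K t f xs) (m≤n+m _ (K * f x))
... | false = +-mono-≤ (<⇒≤ (≰⇒> λ h → subst T eq (≤⇒≤ᵇ h))) (markov-count K t f xs)

markov : {A : Set} (L K t : ℕ) (f : A → ℕ) (xs : List A) → 1 ≤ t →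
  L * K * ∑ xs f ≤ length xs * t → L * # (heavy K t f) xs ≤ length xs
markov L K (suc t) f xs _ h = *-cancelʳ-≤ _ _ (suc t) (begin
  L * # (heavy K (suc t) f) xs * suc t   ≡⟨ *-assoc L _ _ ⟩
  L * (# (heavy K (suc t) f) xs * suc t) ≤⟨ *-monoʳ-≤ L (markov-count K (suc t) f xs) ⟩
  L * (K * ∑ xs f)                       ≡⟨ sym (*-assoc L K _) ⟩
  L * K * ∑ xs f                         ≤⟨ h ⟩
  length xs * suc t                      ∎)
  where open ≤-Reasoning

any-false : {A : Set} {p : A → Bool} {xs : List A} → any p xs ≡ false → ∀ {x} → x ∈ xs → p x ≡ false
any-false {p = p} {y ∷ xs} h m with p y in eq
any-false {p = p} {y ∷ xs} h (here refl) | false = eq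
any-false {p = p} {y ∷ xs} h (there m) | false = any-false h m

any-true⁺ : {A : Set} (p : A → Bool) {xs : List A} {x : A} → x ∈ xs → p x ≡ true → any p xs ≡ true
any-true⁺ p {y ∷ xs} (here refl) e rewrite e = refl
any-true⁺ p {y ∷ xs} (there m) e with p y
... | true = refl
... | false = any-true⁺ p m e

any-true⁻ : {A : Set} (p : A → Bool) (xs : List A) → any p xs ≡ true → ∃ λ x → x ∈ xs × p x ≡ true
any-true⁻ p (y ∷ xs) h with p y in eq
... | true = y , here refl , eq
... | false = let x , m , e = any-true⁻ p xs h in x , there m , e

∧-true : {a b : Bool} → a ∧ b ≡ true → a ≡ true × b ≡ true
∧-true {true} {true} _ = refl , refl

not-true : {b : Bool} → not b ≡ true → b ≡ false
not-true {false} _ = refl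

-- Union bound: each of at most L predicates holds on at most a fraction 1/(2L), so together they
-- cover at most half of `X`. Every list of constraints below is imposed in this way, at the cost of
-- a factor 2.
avoid-half : {A : Set} (X : List A) (L : ℕ) (ps : List (A → Bool)) → length ps ≤ L →
  (∀ p → p ∈ ps → 2 * L * # p X ≤ length X) → length X ≤ 2 * # (λ x → not (any (λ p → p x) ps)) X
avoid-half X L ps len h = final
  where
  open ≤-Reasoning
  bad = λ qs x → any (λ p → p x) qs
  union : ∀ qs → # (bad qs) X ≤ ∑ qs (λ p → # p X)
  union [] = ≤-reflexive (#-false X)
  union (q ∷ qs) = ≤-trans (#-∨ q (bad qs) X) (+-monoʳ-≤ _ (union qs))
  small : ∀ qs L → length qs ≤ L → (∀ p → p ∈ qs → 2 * L * # p X ≤ length X) → 2 * # (bad qs) X ≤ length X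
  small [] zero _ _ = ≤-trans (*-monoʳ-≤ 2 (union [])) z≤n
  small qs (suc L) len' h' = *-cancelˡ-≤ (suc L) (begin
    suc L * (2 * # (bad qs) X)       ≡⟨ trans (sym (*-assoc (suc L) 2 (# (bad qs) X))) (cong (_* # (bad qs) X) (*-comm (suc L) 2)) ⟩
    2 * suc L * # (bad qs) X         ≤⟨ *-monoʳ-≤ (2 * suc L) (union qs) ⟩
    2 * suc L * ∑ qs (λ p → # p X)   ≤⟨ ∑-bound (2 * suc L) (length X) qs h' ⟩
    length qs * length X             ≤⟨ *-monoˡ-≤ (length X) len' ⟩
    suc L * length X                 ∎)
  final : length X ≤ 2 * # (not ∘ bad ps) X
  final = +-cancelˡ-≤ (length X) _ _ (begin
    length X + length X                                  ≡⟨ sym (cong (length X +_) (+-identityʳ _)) ⟩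
    2 * length X                                         ≡⟨ cong (2 *_) (sym (#-compl (bad ps) X)) ⟩
    2 * (# (bad ps) X + # (not ∘ bad ps) X)              ≡⟨ *-distribˡ-+ 2 (# (bad ps) X) _ ⟩
    2 * # (bad ps) X + 2 * # (not ∘ bad ps) X            ≤⟨ +-monoˡ-≤ _ (small ps L len h) ⟩
    length X + 2 * # (not ∘ bad ps) X                    ∎)

-- A sparse pair of large sets

_⊆_ : {A : Set} → List A → List A → Set
xs ⊆ ys = ∀ {x} → x ∈ xs → x ∈ ys

Disjoint : {A : Set} → List A → List A → Set
Disjoint xs ys = ∀ {x} → x ∈ xs → x ∈ ys → ⊥

filterᵇ-⊆ : {A : Set} (p : A → Bool) (xs : List A) → filterᵇ p xs ⊆ xs
filterᵇ-⊆ p xs m = proj₁ (∈-filterᵇ⁻ p xs m)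

take-⊆ : {A : Set} (n : ℕ) (xs : List A) → take n xs ⊆ xs
take-⊆ (suc n) (x ∷ xs) (here e) = here e
take-⊆ (suc n) (x ∷ xs) (there m) = there (take-⊆ n xs m)

drop-⊆ : {A : Set} (n : ℕ) (xs : List A) → drop n xs ⊆ xs
drop-⊆ zero xs m = m
drop-⊆ (suc n) (x ∷ xs) m = there (drop-⊆ n xs m)

take-drop-pairs : {A : Set} {R : A → A → Set} (n : ℕ) {xs : List A} → AllPairs R xs →
  ∀ {x y} → x ∈ take n xs → y ∈ drop n xs → R x y
take-drop-pairs (suc n) {x ∷ xs} (r ∷ rs) (here refl) m = All.lookup r (drop-⊆ n xs m)
take-drop-pairs (suc n) {x ∷ xs} (r ∷ rs) (there l) m = take-drop-pairs n rs l m

chunks : {A : Set} (h m : ℕ) (X : List A) → Unique X → h * m ≤ length X →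
  Σ (Fin h → List A) λ Y → (∀ i → Y i ⊆ X) × (∀ i → Unique (Y i)) ×
    (∀ i j → i ≢ j → Disjoint (Y i) (Y j)) × (∀ i → m ≤ length (Y i))
chunks zero m X u l = (λ ()) , (λ ()) , (λ ()) , (λ ()) , λ ()
chunks {A} (suc h) m X u l = Y , sub , uniq , disj , size
  where
  rest = chunks h m (drop m X) (Unique.drop⁺ m u)
    (≤-trans (≤-reflexive (sym (m+n∸m≡n m (h * m)))) (≤-trans (∸-monoˡ-≤ m l) (≤-reflexive (sym (length-drop m X)))))
  Y : Fin (suc h) → List A
  Y zero = take m X
  Y (suc i) = proj₁ rest i
  sub : ∀ i → Y i ⊆ X
  sub zero = take-⊆ m X
  sub (suc i) = λ k → drop-⊆ m X (proj₁ (proj₂ rest) i k)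
  uniq : ∀ i → Unique (Y i)
  uniq zero = Unique.take⁺ m u
  uniq (suc i) = proj₁ (proj₂ (proj₂ rest)) i
  disj : ∀ i j → i ≢ j → Disjoint (Y i) (Y j)
  disj zero zero n = ⊥-elim (n refl)
  disj zero (suc j) n p q = take-drop-pairs m u p (proj₁ (proj₂ rest) j q) refl
  disj (suc i) zero n q p = take-drop-pairs m u p (proj₁ (proj₂ rest) i q) refl
  disj (suc i) (suc j) n = proj₁ (proj₂ (proj₂ (proj₂ rest))) i j (n ∘ cong suc)
  size : ∀ i → m ≤ length (Y i)
  size zero = ≤-reflexive (sym (trans (length-take m X) (m≤n⇒m⊓n≡m (≤-trans (m≤m+n m (h * m)) l))))
  size (suc i) = proj₂ (proj₂ (proj₂ (proj₂ rest))) i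

-- The size, in units of `s`, that each of h parts needs for a greedy embedding. The factor Λ turns
-- a shortage of candidates in the next part into a density below 1/Λ; the 2h pays for discarding h
-- exceptional sets of size below s, and the 1 keeps the factor positive.
embedFactor : ℕ → ℕ → ℕ
embedFactor Λ zero = 1
embedFactor Λ (suc h) = Λ * embedFactor Λ h + suc (2 * h)

embedFactor-pos : ∀ Λ h → 1 ≤ embedFactor Λ h
embedFactor-pos Λ zero = ≤-refl
embedFactor-pos Λ (suc h) = ≤-trans (s≤s z≤n) (m≤n+m _ (Λ * embedFactor Λ h))

module Tournament {V : Set} (b : V → V → Bool) (b-anti : ∀ x y → x ≢ y → b x y ≡ not (b y x)) where

  edges : List V → List V → ℕ
  edges Q P = ∑ Q (λ q → # (b q) P)

  -- `P` is to become the earlier set and `Q` the later one, so `edges Q P` counts the back edges.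
  record SparsePair (X : List V) (s Λ : ℕ) : Set where
    field
      P Q : List V
      P⊆ : P ⊆ X
      Q⊆ : Q ⊆ X
      P! : Unique P
      Q! : Unique Q
      disjoint : Disjoint P Q
      P-size : s ≤ length P
      Q-size : s ≤ length Q
      sparse : Λ * edges Q P ≤ length P * length Q

  Embedding : (h : ℕ) → (Fin h → Fin h → Bool) → (Fin h → List V) → Set
  Embedding h H Y = Σ (Fin h → V) λ f → (∀ i → f i ∈ Y i) × (∀ i j → i ≢ j → b (f i) (f j) ≡ H i j)

  private
    dir : Bool → V → V → Bool
    dir true v y = b v y
    dir false v y = b y v

    scale : ∀ Λ s c → Λ * (s * c) ≡ s * (Λ * c)
    scale = solve-∀

  -- Greedy embedding: a vertex of the first part is usable if it keeps enough candidates in every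
  -- other part. If at least s vertices fail for the same part, they form a sparse pair with that
  -- part; otherwise at least half of the first part is usable and the candidates are restricted to
  -- its neighbourhoods.
  embed-or-pair : ∀ h (H : Fin h → Fin h → Bool) → (∀ i j → i ≢ j → H i j ≡ not (H j i)) →
    ∀ X Λ s → 1 ≤ s → (Y : Fin h → List V) → (∀ i → Y i ⊆ X) → (∀ i → Unique (Y i)) →
    (∀ i j → i ≢ j → Disjoint (Y i) (Y j)) → (∀ i → s * embedFactor Λ h ≤ length (Y i)) →
    Embedding h H Y ⊎ SparsePair X s Λ
  embed-or-pair zero H Ha X Λ s s≥1 Y sub uniq disj size = inj₁ ((λ ()) , (λ ()) , λ ())
  embed-or-pair (suc h) H Ha X Λ s s≥1 Y sub uniq disj size
    with Fin.any? (λ u → s ≤? # (λ v → # (dir (H zero (suc u)) v) (Y (suc u)) <ᵇ s * embedFactor Λ h) (Y zero))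
  ... | yes (u , many) = inj₂ (pair (H zero (suc u)) refl)
    where
    open ≤-Reasoning
    few : V → Bool
    few v = # (dir (H zero (suc u)) v) (Y (suc u)) <ᵇ s * embedFactor Λ h
    A = filterᵇ few (Y zero)
    U = Y (suc u)
    few-edges : Λ * ∑ A (λ v → # (dir (H zero (suc u)) v) U) ≤ length A * length U
    few-edges = ∑-bound Λ (length U) A λ v m → begin
      Λ * # (dir (H zero (suc u)) v) U   ≤⟨ *-monoʳ-≤ Λ (<⇒≤ (<ᵇ⇒< _ _ (subst T (sym (proj₂ (∈-filterᵇ⁻ few (Y zero) m))) _))) ⟩
      Λ * (s * embedFactor Λ h)          ≡⟨ scale Λ s (embedFactor Λ h) ⟩
      s * (Λ * embedFactor Λ h)          ≤⟨ *-monoʳ-≤ s (m≤m+n _ _) ⟩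
      s * embedFactor Λ (suc h)          ≤⟨ size (suc u) ⟩
      length U                           ∎
    U-size : s ≤ length U
    U-size = ≤-trans (≤-trans (≤-reflexive (sym (*-identityʳ s))) (*-monoʳ-≤ s (embedFactor-pos Λ (suc h)))) (size (suc u))
    -- The direction of the scarce edges decides the order: vertices with few out-neighbours in `U`
    -- form the later set, vertices with few in-neighbours the earlier one.
    pair : ∀ o → H zero (suc u) ≡ o → SparsePair X s Λ
    pair true e = record
      { P = U ; Q = A ; P⊆ = sub (suc u) ; Q⊆ = λ m → sub zero (filterᵇ-⊆ few (Y zero) m)
      ; P! = uniq (suc u) ; Q! = AllPairs-filterᵇ few (uniq zero)
      ; disjoint = λ p q → disj (suc u) zero (λ ()) p (filterᵇ-⊆ few (Y zero) q)
      ; P-size = U-size ; Q-size = many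
      ; sparse = ≤-trans (subst (λ o → Λ * ∑ A (λ v → # (dir o v) U) ≤ length A * length U) e few-edges)
                         (≤-reflexive (*-comm (length A) (length U))) }
    pair false e = record
      { P = A ; Q = U ; Q⊆ = sub (suc u) ; P⊆ = λ m → sub zero (filterᵇ-⊆ few (Y zero) m)
      ; Q! = uniq (suc u) ; P! = AllPairs-filterᵇ few (uniq zero)
      ; disjoint = λ p q → disj (suc u) zero (λ ()) q (filterᵇ-⊆ few (Y zero) p)
      ; Q-size = U-size ; P-size = many
      ; sparse = subst (λ k → Λ * k ≤ length A * length U) (∑-swap (λ v y → b y v) A U)
                   (subst (λ o → Λ * ∑ A (λ v → # (dir o v) U) ≤ length A * length U) e few-edges) }
  ... | no none with #-witness good (Y zero) (*-cancelˡ-< 2 0 _ (≤-trans (≤-trans s≥1 (≤-trans (≤-reflexive (sym (*-identityʳ s))) (≤-trans (*-monoʳ-≤ s (embedFactor-pos Λ (suc h))) (size zero)))) half))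
    where
    open ≤-Reasoning
    few : Fin h → V → Bool
    few u v = # (dir (H zero (suc u)) v) (Y (suc u)) <ᵇ s * embedFactor Λ h
    good : V → Bool
    good v = not (any (λ p → p v) (map few (allFin h)))
    half : length (Y zero) ≤ 2 * # good (Y zero)
    half = avoid-half (Y zero) h (map few (allFin h)) (≤-reflexive (trans (length-map few (allFin h)) (length-tabulate (λ i → i)))) λ p m → rare p (∈-map⁻ few m)
      where
      rare : ∀ p → (∃ λ u → u ∈ allFin h × p ≡ few u) → 2 * h * # p (Y zero) ≤ length (Y zero)
      rare p (u , _ , refl) = begin
        2 * h * # (few u) (Y zero)   ≤⟨ *-monoʳ-≤ (2 * h) (<⇒≤ (≰⇒> λ l → none (u , l))) ⟩
        2 * h * s                    ≡⟨ *-comm (2 * h) s ⟩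
        s * (2 * h)                  ≤⟨ *-monoʳ-≤ s (≤-trans (n≤1+n _) (m≤n+m _ (Λ * embedFactor Λ h))) ⟩
        s * embedFactor Λ (suc h)    ≤⟨ size zero ⟩
        length (Y zero)              ∎
  ... | v , v∈ , v-good with embed-or-pair h (λ i j → H (suc i) (suc j)) (λ i j n → Ha (suc i) (suc j) (n ∘ Fin.suc-injective)) X Λ s s≥1 Y'
        (λ i m → sub (suc i) (filterᵇ-⊆ _ (Y (suc i)) m)) (λ i → AllPairs-filterᵇ _ (uniq (suc i)))
        (λ i j n p q → disj (suc i) (suc j) (n ∘ Fin.suc-injective) (filterᵇ-⊆ _ (Y (suc i)) p) (filterᵇ-⊆ _ (Y (suc j)) q)) size'
    where
    Y' : Fin h → List V
    Y' u = filterᵇ (dir (H zero (suc u)) v) (Y (suc u))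
    size' : ∀ u → s * embedFactor Λ h ≤ length (Y' u)
    size' u = ≮⇒≥ λ l → ⊥-true (<ᵇ-true l) (any-false (not-true v-good) (∈-map⁺ _ (∈-allFin u)))
  ... | inj₂ pr = inj₂ pr
  ... | inj₁ (f , f∈ , f-ok) = inj₁ (g , g∈ , g-ok)
    where
    g : Fin (suc h) → V
    g zero = v
    g (suc i) = f i
    g∈ : ∀ i → g i ∈ Y i
    g∈ zero = v∈
    g∈ (suc i) = filterᵇ-⊆ _ (Y (suc i)) (f∈ i)
    new : ∀ u o → H zero (suc u) ≡ o → dir o v (f u) ≡ true → b v (f u) ≡ o
    new u true e d = d
    new u false e d = trans (b-anti v (f u) (λ { refl → disj zero (suc u) (λ ()) v∈ (g∈ (suc u)) })) (cong not d)
    new' : ∀ u → b v (f u) ≡ H zero (suc u)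
    new' u = new u _ refl (proj₂ (∈-filterᵇ⁻ _ (Y (suc u)) (f∈ u)))
    g-ok : ∀ i j → i ≢ j → b (g i) (g j) ≡ H i j
    g-ok zero zero n = ⊥-elim (n refl)
    g-ok zero (suc u) n = new' u
    g-ok (suc u) zero n = trans (b-anti (f u) v (λ e → disj zero (suc u) (λ ()) v∈ (subst (_∈ Y (suc u)) e (g∈ (suc u)))))
      (trans (cong not (new' u)) (sym (Ha (suc u) zero (λ ()))))
    g-ok (suc i) (suc j) n = f-ok i j (n ∘ cong suc)

  Copy : (h : ℕ) → (Fin h → Fin h → Bool) → Set
  Copy h H = Σ (Fin h → V) λ f → ∀ i j → i ≢ j → b (f i) (f j) ≡ H i j

  abstract
    sparse-pair : ∀ h (H : Fin h → Fin h → Bool) → (∀ i j → i ≢ j → H i j ≡ not (H j i)) → ¬ Copy h H →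
      ∀ Λ s → 1 ≤ s → ∀ X → Unique X → h * (s * embedFactor Λ h) ≤ length X → SparsePair X s Λ
    sparse-pair h H Ha free Λ s s≥1 X X! big with chunks h (s * embedFactor Λ h) X X! big
    ... | Y , sub , uniq , disj , size with embed-or-pair h H Ha X Λ s s≥1 Y sub uniq disj size
    ... | inj₁ (f , _ , ok) = ⊥-elim (free (f , ok))
    ... | inj₂ p = p

-- Sequences of large and transitive blocks

length-cartesianProduct : {A B : Set} (xs : List A) (ys : List B) → length (cartesianProduct xs ys) ≡ length xs * length ys
length-cartesianProduct [] ys = refl
length-cartesianProduct (x ∷ xs) ys = trans (length-++ (map (x ,_) ys)) (cong₂ _+_ (length-map _ ys) (length-cartesianProduct xs ys))

slots : ℕ → ℕ → List (ℕ × ℕ)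
slots M N = cartesianProduct (upTo M) (upTo N)

length-slots : ∀ M N → length (slots M N) ≡ M * N
length-slots M N = trans (length-cartesianProduct (upTo M) (upTo N)) (cong₂ _*_ (length-upTo M) (length-upTo N))

∈-slots⁺ : ∀ {M N i u} → i < M → u < N → (i , u) ∈ slots M N
∈-slots⁺ p q = ∈-cartesianProduct⁺ (∈-upTo⁺ p) (∈-upTo⁺ q)

∈-slots⁻ : ∀ {M N i u} → (i , u) ∈ slots M N → i < M × u < N
∈-slots⁻ {M} {N} m = let p , q = ∈-cartesianProduct⁻ (upTo M) (upTo N) m in ∈-upTo⁻ p , ∈-upTo⁻ q

light-half : {A : Set} (K t : ℕ) (f : A → ℕ) (xs : List A) → 1 ≤ t → 2 * K * ∑ xs f ≤ length xs * t →
  length xs ≤ 2 * # (not ∘ heavy K t f) xs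
light-half K t f xs t≥1 h = +-cancelˡ-≤ (length xs) _ _ (begin
  length xs + length xs                          ≡⟨ sym (cong (length xs +_) (+-identityʳ _)) ⟩
  2 * length xs                                  ≡⟨ cong (2 *_) (sym (#-compl (heavy K t f) xs)) ⟩
  2 * (# (heavy K t f) xs + # (not ∘ heavy K t f) xs) ≡⟨ *-distribˡ-+ 2 (# (heavy K t f) xs) _ ⟩
  2 * # (heavy K t f) xs + 2 * # (not ∘ heavy K t f) xs ≤⟨ +-monoˡ-≤ _ (markov 2 K t f xs t≥1 h) ⟩
  length xs + 2 * # (not ∘ heavy K t f) xs       ∎)
  where open ≤-Reasoning

-- In units of `s`, the size that suffices for M blocks. One more block costs an application of
-- `sparse-pair` to H on h vertices, with a pair dense enough in vertices to lose half of each side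
-- and still hold the remaining M blocks in `Q`.
blockFactor : ℕ → ℕ → ℕ → ℕ → ℕ
blockFactor h N Λ zero = 1
blockFactor h N Λ (suc M) = h * (2 * blockFactor h N Λ M * embedFactor (2 * (2 * (M * N) * Λ)) h)

blockFactor-pos : ∀ {h} → 1 ≤ h → ∀ N Λ M → 1 ≤ blockFactor h N Λ M
blockFactor-pos h≥1 N Λ zero = ≤-refl
blockFactor-pos {h} h≥1 N Λ (suc M) = *-mono-≤ h≥1 (*-mono-≤ (*-mono-≤ {1} {2} (s≤s z≤n) (blockFactor-pos h≥1 N Λ M)) (embedFactor-pos (2 * (2 * (M * N) * Λ)) h))

module Structure {V : Set} (b : V → V → Bool) (b-anti : ∀ x y → x ≢ y → b x y ≡ not (b y x)) where
  open Tournament b b-anti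

  _⟶_ : V → V → Set
  x ⟶ y = b x y ≡ true

  -- Block i consists of the pieces Y i u.  When tr i holds they are consecutive intervals of one transitive set;
  -- otherwise the block is a single large set, and all its pieces are equal.
  record Blocks (X : List V) (tr : ℕ → Bool) (M N s t Λ : ℕ) : Set where
    field
      Y : ℕ → ℕ → List V
      Y⊆ : ∀ {i u} → i < M → u < N → Y i u ⊆ X
      Y! : ∀ {i u} → i < M → u < N → Unique (Y i u)
      lin-size : ∀ {i u} → i < M → u < N → tr i ≡ false → s ≤ length (Y i u)
      tr-size : ∀ {i u} → i < M → u < N → tr i ≡ true → t ≤ length (Y i u)
      tr-pairs : ∀ {i u} → i < M → u < N → tr i ≡ true → AllPairs _⟶_ (Y i u)
      tr-fwd : ∀ {i u v x y} → i < M → u < v → v < N → tr i ≡ true → x ∈ Y i u → y ∈ Y i v → x ⟶ y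
      disjoint : ∀ {i j u v} → i < j → j < M → u < N → v < N → Disjoint (Y i u) (Y j v)
      sparse : ∀ {i j u v} → i < j → j < M → u < N → v < N →
        Λ * edges (Y j v) (Y i u) ≤ length (Y i u) * length (Y j v)

    size-pos : 1 ≤ s → 1 ≤ t → ∀ {i u} → i < M → u < N → 1 ≤ length (Y i u)
    size-pos s≥1 t≥1 {i} p q with tr i in eq
    ... | false = ≤-trans s≥1 (lin-size p q eq)
    ... | true = ≤-trans t≥1 (tr-size p q eq)

  module _ (h : ℕ) (H : Fin h → Fin h → Bool) (H-anti : ∀ i j → i ≢ j → H i j ≡ not (H j i)) (h≥1 : 1 ≤ h)
           (N Λ : ℕ) where

    module _ (free : ¬ Copy h H) (s t : ℕ) (s≥1 : 1 ≤ s) (t≥1 : 1 ≤ t) (X₀ : List V)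
             (transitive : ∀ Z → Unique Z → Z ⊆ X₀ → s ≤ length Z →
               ∃ λ ts → ts ⊆ Z × AllPairs _⟶_ ts × Unique ts × N * t ≤ length ts) where

      -- Transitive pieces are chosen inside a sparse pair only after the bound holds vertex by
      -- vertex. `Q` is thinned so that each vertex sends few edges into `P`; the later blocks are
      -- built inside it; then `P` is thinned so that each vertex receives few edges from every
      -- finished piece. The first block can now be any subset of what is left of `P`.
      blocks : ∀ M (tr : ℕ → Bool) X → Unique X → X ⊆ X₀ → s * blockFactor h N Λ M ≤ length X → Blocks X tr M N s t Λ
      blocks zero tr X X! X⊆ big = record
        { Y = λ _ _ → [] ; Y⊆ = λ () ; Y! = λ () ; lin-size = λ () ; tr-size = λ () ; tr-pairs = λ () ; tr-fwd = λ ()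
        ; disjoint = λ _ () ; sparse = λ _ () }
      blocks (suc M) tr X X! X⊆ big = record
        { Y = Y ; Y⊆ = sub ; Y! = uniq ; lin-size = lin ; tr-size = trs ; tr-pairs = trp ; tr-fwd = trf ; disjoint = disj ; sparse = spr }
        where
        open ≤-Reasoning
        L = M * N
        -- With this K, Markov's inequality with threshold 1/Λ discards at most a fraction 1/(2L) of
        -- `P` for each of the L later pieces.
        K = 2 * L * Λ
        s' = 2 * blockFactor h N Λ M * s
        s'≥2s : 2 * s ≤ s'
        s'≥2s = *-monoˡ-≤ s (≤-trans (≤-reflexive (sym (*-identityʳ 2))) (*-monoʳ-≤ 2 (blockFactor-pos h≥1 N Λ M)))
        arrange : ∀ s h c e → s * (h * (2 * c * e)) ≡ h * (2 * c * s * e)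
        arrange = solve-∀
        pr = sparse-pair h H H-anti free (2 * K) s' (≤-trans (≤-trans s≥1 (m≤m+n s _)) s'≥2s) X X!
               (≤-trans (≤-reflexive (sym (arrange s h (blockFactor h N Λ M) (embedFactor (2 * K) h)))) big)
        open SparsePair pr
        lightQ : V → Bool
        lightQ = not ∘ heavy K (length P) (λ q → # (b q) P)
        P-pos : 1 ≤ length P
        P-pos = ≤-trans (≤-trans (≤-trans s≥1 (m≤m+n s _)) s'≥2s) P-size
        Q' = filterᵇ lightQ Q
        Q'-light : ∀ {q} → q ∈ Q' → K * # (b q) P ≤ length P
        Q'-light m = heavy-false K (length P) (λ q → # (b q) P) _ (not-true (proj₂ (∈-filterᵇ⁻ lightQ Q m)))
        Q'-size : s * blockFactor h N Λ M ≤ length Q'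
        Q'-size = *-cancelˡ-≤ 2 (begin
          2 * (s * blockFactor h N Λ M) ≡⟨ trans (cong (2 *_) (*-comm s _)) (sym (*-assoc 2 (blockFactor h N Λ M) s)) ⟩
          s'                      ≤⟨ Q-size ⟩
          length Q                ≤⟨ light-half K (length P) (λ q → # (b q) P) Q P-pos (≤-trans sparse (≤-reflexive (*-comm (length P) _))) ⟩
          2 * length Q'           ∎)
        inner = blocks M (tr ∘ suc) Q' (AllPairs-filterᵇ lightQ Q!) (λ m → X⊆ (Q⊆ (filterᵇ-⊆ lightQ Q m))) Q'-size
        module I = Blocks inner
        into : ℕ × ℕ → V → ℕ
        into (i , u) p = # (λ q → b q p) (I.Y i u)
        heavyP : ℕ × ℕ → V → Bool
        heavyP (i , u) = heavy Λ (length (I.Y i u)) (into (i , u))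
        lightP : V → Bool
        lightP p = not (any (λ f → f p) (map heavyP (slots M N)))
        P' = filterᵇ lightP P
        rare : ∀ f → (∃ λ k → k ∈ slots M N × f ≡ heavyP k) → 2 * L * # f P ≤ length P
        rare f ((i , u) , k∈ , refl) = markov (2 * L) Λ (length (I.Y i u)) (into (i , u)) P (I.size-pos s≥1 t≥1 i< u<) (begin
          K * ∑ P (into (i , u))            ≡⟨ cong (K *_) (∑-swap (λ p q → b q p) P (I.Y i u)) ⟩
          K * edges (I.Y i u) P             ≤⟨ ∑-bound K (length P) (I.Y i u) (λ q m → Q'-light (I.Y⊆ i< u< m)) ⟩
          length (I.Y i u) * length P       ≡⟨ *-comm (length (I.Y i u)) _ ⟩
          length P * length (I.Y i u)       ∎)
          where
          i< = proj₁ (∈-slots⁻ {M} {N} k∈)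
          u< = proj₂ (∈-slots⁻ {M} {N} k∈)
        P'-size : s ≤ length P'
        P'-size = *-cancelˡ-≤ 2 (≤-trans s'≥2s (≤-trans P-size
          (avoid-half P L (map heavyP (slots M N)) (≤-reflexive (trans (length-map heavyP (slots M N)) (length-slots M N))) (λ f m → rare f (∈-map⁻ heavyP m)))))
        P'-light : ∀ {i u p} → i < M → u < N → p ∈ P' → Λ * into (i , u) p ≤ length (I.Y i u)
        P'-light {i} {u} i< u< m = heavy-false Λ (length (I.Y i u)) (into (i , u)) _ (any-false (not-true (proj₂ (∈-filterᵇ⁻ lightP P m))) (∈-map⁺ heavyP (∈-slots⁺ i< u<)))
        P'! = AllPairs-filterᵇ lightP P!
        P'⊆ : P' ⊆ P
        P'⊆ = filterᵇ-⊆ lightP P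
        tset = transitive P' P'! (λ m → X⊆ (P⊆ (P'⊆ m))) P'-size
        ts = proj₁ tset
        head : Bool → ℕ → List V
        head false u = P'
        head true u = take t (drop (u * t) ts)
        head⊆ : ∀ o u → head o u ⊆ P'
        head⊆ false u m = m
        head⊆ true u m = proj₁ (proj₂ tset) (drop-⊆ (u * t) ts (take-⊆ t (drop (u * t) ts) m))
        head! : ∀ o u → Unique (head o u)
        head! false u = P'!
        head! true u = AllPairs.take⁺ t (AllPairs.drop⁺ (u * t) (proj₁ (proj₂ (proj₂ (proj₂ tset)))))
        Y : ℕ → ℕ → List V
        Y zero u = head (tr 0) u
        Y (suc i) u = I.Y i u
        sub : ∀ {i u} → i < suc M → u < N → Y i u ⊆ X
        sub {zero} {u} p q m = P⊆ (P'⊆ (head⊆ (tr 0) u m))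
        sub {suc i} p q m = Q⊆ (filterᵇ-⊆ lightQ Q (I.Y⊆ (s≤s⁻¹ p) q m))
        uniq : ∀ {i u} → i < suc M → u < N → Unique (Y i u)
        uniq {zero} {u} p q = head! (tr 0) u
        uniq {suc i} p q = I.Y! (s≤s⁻¹ p) q
        lin : ∀ {i u} → i < suc M → u < N → tr i ≡ false → s ≤ length (Y i u)
        lin {zero} p q e rewrite e = P'-size
        lin {suc i} p q e = I.lin-size (s≤s⁻¹ p) q e
        piece-size : ∀ {u} → u < N → t ≤ length (take t (drop (u * t) ts))
        piece-size {u} q = ≤-reflexive (sym (trans (length-take t (drop (u * t) ts)) (m≤n⇒m⊓n≡m (≤-trans room (≤-reflexive (sym (length-drop (u * t) ts)))))))
          where
          room : t ≤ length ts ∸ u * t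
          room = ≤-trans (≤-reflexive (sym (m+n∸n≡m t (u * t)))) (∸-monoˡ-≤ (u * t) (≤-trans (*-monoˡ-≤ t q) (proj₂ (proj₂ (proj₂ (proj₂ tset))))))
        trs : ∀ {i u} → i < suc M → u < N → tr i ≡ true → t ≤ length (Y i u)
        trs {zero} p q e rewrite e = piece-size q
        trs {suc i} p q e = I.tr-size (s≤s⁻¹ p) q e
        trp : ∀ {i u} → i < suc M → u < N → tr i ≡ true → AllPairs _⟶_ (Y i u)
        trp {zero} {u} p q e rewrite e = AllPairs.take⁺ t (AllPairs.drop⁺ (u * t) (proj₁ (proj₂ (proj₂ tset))))
        trp {suc i} p q e = I.tr-pairs (s≤s⁻¹ p) q e
        early-late : ∀ (zs : List V) u v → AllPairs _⟶_ zs → u < v → ∀ {x y} →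
          x ∈ take t (drop (u * t) zs) → y ∈ drop (v * t) zs → x ⟶ y
        early-late zs zero (suc v) ap l {x} {y} m k = take-drop-pairs t ap m (drop-⊆ (v * t) (drop t zs) (subst (y ∈_) (sym (drop-drop t (v * t) zs)) k))
        early-late zs (suc u) (suc v) ap l {x} {y} m k = early-late (drop t zs) u v (AllPairs.drop⁺ t ap) (s≤s⁻¹ l)
          (subst (λ l → x ∈ take t l) (sym (drop-drop t (u * t) zs)) m) (subst (y ∈_) (sym (drop-drop t (v * t) zs)) k)
        trf : ∀ {i u v x y} → i < suc M → u < v → v < N → tr i ≡ true → x ∈ Y i u → y ∈ Y i v → x ⟶ y
        trf {zero} {u} {v} p l q e m k rewrite e = early-late ts u v (proj₁ (proj₂ (proj₂ tset))) l m (take-⊆ t (drop (v * t) ts) k)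
        trf {suc i} p l q e m k = I.tr-fwd (s≤s⁻¹ p) l q e m k
        disj : ∀ {i j u v} → i < j → j < suc M → u < N → v < N → Disjoint (Y i u) (Y j v)
        disj {zero} {suc j} {u} l p q r m k = disjoint (P'⊆ (head⊆ (tr 0) u m)) (filterᵇ-⊆ lightQ Q (I.Y⊆ (s≤s⁻¹ p) r k))
        disj {suc i} {suc j} l p q r = I.disjoint (s≤s⁻¹ l) (s≤s⁻¹ p) q r
        spr : ∀ {i j u v} → i < j → j < suc M → u < N → v < N → Λ * edges (Y j v) (Y i u) ≤ length (Y i u) * length (Y j v)
        -- The bound is summed over the vertices of the first block, so it holds for a short
        -- interval of `ts` as well as for the whole of `P'`.
        spr {zero} {suc j} {u} {v} l p q r = begin
          Λ * edges (I.Y j v) (head (tr 0) u)     ≡⟨ cong (Λ *_) (∑-swap b (I.Y j v) (head (tr 0) u)) ⟩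
          Λ * ∑ (head (tr 0) u) (into (j , v))    ≤⟨ ∑-bound Λ _ (head (tr 0) u) (λ x m → P'-light (s≤s⁻¹ p) r (head⊆ (tr 0) u m)) ⟩
          length (head (tr 0) u) * length (I.Y j v) ∎
        spr {suc i} {suc j} l p q r = I.sparse (s≤s⁻¹ l) (s≤s⁻¹ p) q r

-- Smoothing

<ᵇ-false : ∀ {i j} → j ≤ i → (i <ᵇ j) ≡ false
<ᵇ-false {i} {j} l with i <ᵇ j in eq
... | false = refl
... | true = ⊥-elim (<⇒≱ (<ᵇ⇒< i j (subst T (sym eq) _)) l)

module Hosts {V : Set} (b : V → V → Bool) (b-anti : ∀ x y → x ≢ y → b x y ≡ not (b y x)) where
  open Tournament b b-anti
  open Structure b b-anti

  -- back i j x y: the edge between x in block i and y in block j points from the later block to the earlier one.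
  back : ℕ → ℕ → V → V → Bool
  back i j x y = if i <ᵇ j then b y x else b x y

  back-< : ∀ {i j} x y → i < j → back i j x y ≡ b y x
  back-< x y l rewrite <ᵇ-true l = refl

  back-> : ∀ {i j} x y → j < i → back i j x y ≡ b x y
  back-> {i} {j} x y l rewrite <ᵇ-false (<⇒≤ l) = refl

  flip : ∀ {x y} → x ≢ y → b x y ≡ false → y ⟶ x
  flip {x} {y} n e = trans (b-anti y x (n ∘ sym)) (cong not e)

  -- The regularity needed for embedding: `smooth` bounds back edges from above at every vertex,
  -- `dense` bounds them from below for sizeable subsets. Two transitive blocks are excluded from
  -- `dense`, since minimality gives nothing there.
  record Host (X : List V) (tr : ℕ → Bool) (M N E D : ℕ) : Set where
    field
      Z : ℕ → ℕ → List V
      Z⊆ : ∀ {i u} → i < M → u < N → Z i u ⊆ X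
      Z-pos : ∀ {i u} → i < M → u < N → 1 ≤ length (Z i u)
      apart : ∀ {i j u v x y} → i ≢ j → i < M → j < M → u < N → v < N → x ∈ Z i u → y ∈ Z j v → x ≢ y
      forward : ∀ {i u v x y} → i < M → u < v → v < N → tr i ≡ true → x ∈ Z i u → y ∈ Z i v → x ⟶ y
      smooth : ∀ {i j u v x} → i ≢ j → i < M → j < M → u < N → v < N → x ∈ Z i u →
        E * # (back i j x) (Z j v) ≤ length (Z j v)
      dense : ∀ {i j u v} → i ≢ j → i < M → j < M → u < N → v < N → ¬ (tr i ≡ true × tr j ≡ true) →
        (P Q : V → Bool) → length (Z i u) ≤ D * # P (Z i u) → length (Z j v) ≤ D * # Q (Z j v) →
        ∃ λ x → ∃ λ y → x ∈ Z i u × P x ≡ true × y ∈ Z j v × Q y ≡ true × back i j x y ≡ true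

  Complete : List V → List V → Set
  Complete A B = ∀ {x y} → x ∈ A → y ∈ B → x ⟶ y

  module _ {X : List V} {tr : ℕ → Bool} {M N s t E D : ℕ} (s≥1 : 1 ≤ s) (t≥1 : 1 ≤ t)
           (large-large : ∀ A B → Unique A → Unique B → A ⊆ X → B ⊆ X → s ≤ 2 * D * length A → s ≤ 2 * D * length B → ¬ Complete A B)
           (large-transitive : ∀ A S → Unique A → AllPairs _⟶_ S → A ⊆ X → S ⊆ X → s ≤ 2 * D * length A → t ≤ 2 * D * length S →
             ¬ (Complete A S ⊎ Complete S A))
           (bl : Blocks X tr M N s t (2 * (M * N) * (2 * E))) where

    open Blocks bl

    private
      distinct : ∀ {i j u v x y} → i ≢ j → i < M → j < M → u < N → v < N → x ∈ Y i u → y ∈ Y j v → x ≢ y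
      distinct {i} {j} n p q r w k l refl with <-cmp i j
      ... | tri< lt _ _ = disjoint lt q r w k l
      ... | tri≈ _ e _ = n e
      ... | tri> _ _ gt = disjoint gt p w r l k

      backs : ℕ → ℕ × ℕ → V → ℕ
      backs i (j , v) x = # (back i j x) (Y j v)

      -- Within one block no sparsity is known, so equal indices impose nothing. The threshold uses
      -- 2E because the pieces shrink by up to a factor 2 when the rough vertices are removed.
      rough : ℕ → ℕ × ℕ → V → Bool
      rough i (j , v) x = if i ≡ᵇ j then false else heavy (2 * E) (length (Y j v)) (backs i (j , v)) x

      smoothed : ℕ → V → Bool
      smoothed i x = not (any (λ p → p x) (map (rough i) (slots M N)))

      Z : ℕ → ℕ → List V
      Z i u = filterᵇ (smoothed i) (Y i u)

      total-backs : ∀ {i j u v} → i ≢ j → i < M → j < M → u < N → v < N →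
        2 * (M * N) * (2 * E) * ∑ (Y i u) (backs i (j , v)) ≤ length (Y i u) * length (Y j v)
      total-backs {i} {j} {u} {v} n p q r w with <-cmp i j
      ... | tri< lt _ _ = subst (λ k → 2 * (M * N) * (2 * E) * k ≤ length (Y i u) * length (Y j v))
              (trans (∑-swap b (Y j v) (Y i u)) (∑-cong (Y i u) (λ x → #-cong (Y j v) (λ y _ → sym (back-< x y lt))))) (sparse lt q r w)
      ... | tri≈ _ e _ = ⊥-elim (n e)
      ... | tri> _ _ gt = subst₂ (λ k l → 2 * (M * N) * (2 * E) * k ≤ l)
              (∑-cong (Y i u) (λ x → #-cong (Y j v) (λ y _ → sym (back-> x y gt)))) (*-comm (length (Y j v)) _) (sparse gt p w r)

      rare : ∀ {i u} → i < M → u < N → ∀ f → (∃ λ k → k ∈ slots M N × f ≡ rough i k) → 2 * (M * N) * # f (Y i u) ≤ length (Y i u)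
      rare {i} {u} p q f ((j , v) , k∈ , refl) with i ≡ᵇ j in eq
      ... | true = ≤-trans (≤-reflexive (trans (cong (2 * (M * N) *_) (#-false (Y i u))) (*-zeroʳ (2 * (M * N))))) z≤n
      ... | false = markov (2 * (M * N)) (2 * E) (length (Y j v)) (backs i (j , v)) (Y i u)
              (size-pos s≥1 t≥1 (proj₁ (∈-slots⁻ {M} {N} k∈)) (proj₂ (∈-slots⁻ {M} {N} k∈)))
              (total-backs (λ e → subst T eq (≡⇒≡ᵇ i j e)) p (proj₁ (∈-slots⁻ {M} {N} k∈)) q (proj₂ (∈-slots⁻ {M} {N} k∈)))

      half : ∀ {i u} → i < M → u < N → length (Y i u) ≤ 2 * length (Z i u)
      half {i} {u} p q = avoid-half (Y i u) (M * N) (map (rough i) (slots M N))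
        (≤-reflexive (trans (length-map (rough i) (slots M N)) (length-slots M N))) (λ f m → rare p q f (∈-map⁻ (rough i) m))

      not-rough : ∀ i j v x → i ≢ j → rough i (j , v) x ≡ false → 2 * E * backs i (j , v) x ≤ length (Y j v)
      not-rough i j v x n e with i ≡ᵇ j in eq
      ... | true = ⊥-elim (n (≡ᵇ⇒≡ i j (subst T (sym eq) _)))
      ... | false = heavy-false (2 * E) (length (Y j v)) (backs i (j , v)) x e

      Z⊆Y : ∀ {i u} → Z i u ⊆ Y i u
      Z⊆Y {i} {u} = filterᵇ-⊆ (smoothed i) (Y i u)

      smooth : ∀ {i j u v x} → i ≢ j → i < M → j < M → u < N → v < N → x ∈ Z i u → E * # (back i j x) (Z j v) ≤ length (Z j v)
      smooth {i} {j} {u} {v} {x} n p q r w m = *-cancelˡ-≤ 2 (begin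
        2 * (E * # (back i j x) (Z j v))   ≤⟨ *-monoʳ-≤ 2 (*-monoʳ-≤ E (#-filter-≤ (back i j x) (smoothed j) (Y j v))) ⟩
        2 * (E * backs i (j , v) x)        ≡⟨ sym (*-assoc 2 E (backs i (j , v) x)) ⟩
        2 * E * backs i (j , v) x          ≤⟨ not-rough i j v x n (any-false (not-true (proj₂ (∈-filterᵇ⁻ (smoothed i) (Y i u) m))) (∈-map⁺ (rough i) (∈-slots⁺ q w))) ⟩
        length (Y j v)                     ≤⟨ half q w ⟩
        2 * length (Z j v)                 ∎)
        where open ≤-Reasoning

      nice : ∀ {i u k} (P : V → Bool) → i < M → u < N → k ≤ length (Y i u) → length (Z i u) ≤ D * # P (Z i u) → k ≤ 2 * D * # P (Z i u)
      nice {i} {u} {k} P p q l h = begin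
        k                          ≤⟨ l ⟩
        length (Y i u)             ≤⟨ half p q ⟩
        2 * length (Z i u)         ≤⟨ *-monoʳ-≤ 2 h ⟩
        2 * (D * # P (Z i u))      ≡⟨ sym (*-assoc 2 D _) ⟩
        2 * D * # P (Z i u)        ∎
        where open ≤-Reasoning

      no-complete : ∀ {i j u v} → i < M → j < M → u < N → v < N → ¬ (tr i ≡ true × tr j ≡ true) →
        (P Q : V → Bool) → length (Z i u) ≤ D * # P (Z i u) → length (Z j v) ≤ D * # Q (Z j v) →
        ¬ Complete (filterᵇ P (Z i u)) (filterᵇ Q (Z j v))
      no-complete {i} {j} {u} {v} p q r w k P Q hP hQ c with tr i in ei | tr j in ej
      ... | true | true = k (refl , refl)
      ... | false | false = large-large _ _ (AllPairs-filterᵇ P (AllPairs-filterᵇ _ (Y! p r))) (AllPairs-filterᵇ Q (AllPairs-filterᵇ _ (Y! q w)))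
              (λ m → Y⊆ p r (Z⊆Y (filterᵇ-⊆ P _ m))) (λ m → Y⊆ q w (Z⊆Y (filterᵇ-⊆ Q _ m)))
              (nice P p r (lin-size p r ei) hP) (nice Q q w (lin-size q w ej) hQ) c
      ... | false | true = large-transitive _ _ (AllPairs-filterᵇ P (AllPairs-filterᵇ _ (Y! p r))) (AllPairs-filterᵇ Q (AllPairs-filterᵇ _ (tr-pairs q w ej)))
              (λ m → Y⊆ p r (Z⊆Y (filterᵇ-⊆ P _ m))) (λ m → Y⊆ q w (Z⊆Y (filterᵇ-⊆ Q _ m)))
              (nice P p r (lin-size p r ei) hP) (nice Q q w (tr-size q w ej) hQ) (inj₁ c)
      ... | true | false = large-transitive _ _ (AllPairs-filterᵇ Q (AllPairs-filterᵇ _ (Y! q w))) (AllPairs-filterᵇ P (AllPairs-filterᵇ _ (tr-pairs p r ei)))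
              (λ m → Y⊆ q w (Z⊆Y (filterᵇ-⊆ Q _ m))) (λ m → Y⊆ p r (Z⊆Y (filterᵇ-⊆ P _ m)))
              (nice Q q w (lin-size q w ej) hQ) (nice P p r (tr-size p r ei) hP) (inj₂ c)

      -- Without a back edge all edges between the two subsets would point forward, making one
      -- complete to the other. Searching with `any` turns this argument by contradiction into
      -- explicit vertices.
      dense : ∀ {i j u v} → i ≢ j → i < M → j < M → u < N → v < N → ¬ (tr i ≡ true × tr j ≡ true) →
        (P Q : V → Bool) → length (Z i u) ≤ D * # P (Z i u) → length (Z j v) ≤ D * # Q (Z j v) →
        ∃ λ x → ∃ λ y → x ∈ Z i u × P x ≡ true × y ∈ Z j v × Q y ≡ true × back i j x y ≡ true
      dense {i} {j} {u} {v} n p q r w k P Q hP hQ with any (λ x → P x ∧ any (λ y → Q y ∧ back i j x y) (Z j v)) (Z i u) in eq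
      ... | true = let x , x∈ , e = any-true⁻ _ (Z i u) eq ; Px , e' = ∧-true e ; y , y∈ , e'' = any-true⁻ _ (Z j v) e' ; Qy , bk = ∧-true e''
                   in x , y , x∈ , Px , y∈ , Qy , bk
      ... | false = ⊥-elim (case (<-cmp i j))
        where
        no-back : ∀ {x y} → x ∈ filterᵇ P (Z i u) → y ∈ filterᵇ Q (Z j v) → back i j x y ≡ false
        no-back {x} {y} m l with back i j x y in e
        ... | false = refl
        ... | true = let x∈ , Px = ∈-filterᵇ⁻ P (Z i u) m ; y∈ , Qy = ∈-filterᵇ⁻ Q (Z j v) l in
              ⊥-elim (⊥-true (any-true⁺ _ x∈ (trans (cong₂ _∧_ Px (any-true⁺ _ y∈ (trans (cong (_∧ back i j x y) Qy) e))) refl)) eq)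
        neq : ∀ {x y} → x ∈ filterᵇ P (Z i u) → y ∈ filterᵇ Q (Z j v) → x ≢ y
        neq m l = distinct n p q r w (Z⊆Y (filterᵇ-⊆ P (Z i u) m)) (Z⊆Y (filterᵇ-⊆ Q (Z j v) l))
        case : _ → ⊥
        case (tri< lt _ _) = no-complete p q r w k P Q hP hQ (λ {x} {y} m l → flip (neq m l ∘ sym) (trans (sym (back-< x y lt)) (no-back m l)))
        case (tri≈ _ e _) = n e
        case (tri> _ _ gt) = no-complete q p w r (λ (a , c) → k (c , a)) Q P hQ hP (λ {y} {x} l m → flip (neq m l) (trans (sym (back-> x y gt)) (no-back m l)))

    host : Host X tr M N E D
    host = record
      { Z = Z
      ; Z⊆ = λ p q m → Y⊆ p q (Z⊆Y m)
      ; Z-pos = λ {i} {u} p q → *-cancelˡ-< 2 0 _ (≤-trans (size-pos s≥1 t≥1 p q) (half p q))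
      ; apart = λ n p q r w k l → distinct n p q r w (Z⊆Y k) (Z⊆Y l)
      ; forward = λ p l q e m k → tr-fwd p l q e (Z⊆Y m) (Z⊆Y k)
      ; smooth = smooth
      ; dense = dense }

-- Stars of back edges and copies of H_l

odd : ℕ → Bool
odd zero = false
odd (suc n) = not (odd n)

Slot : Set
Slot = ℕ × ℕ

HlBack? : ∀ x y → Dec (HlBack x y)
HlBack? 0F _ = no λ ()
HlBack? 1F _ = no λ ()
HlBack? 2F _ = no λ ()
HlBack? 3F 0F = yes e41
HlBack? 3F (suc _) = no λ ()
HlBack? 4F 0F = no λ ()
HlBack? 4F 1F = no λ ()
HlBack? 4F 2F = yes e53
HlBack? 4F (suc (suc (suc _))) = no λ ()
HlBack? 5F 0F = yes e61
HlBack? 5F 1F = yes e62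
HlBack? 5F (suc (suc _)) = no λ ()
HlBack? 6F 0F = no λ ()
HlBack? 6F 1F = no λ ()
HlBack? 6F 2F = no λ ()
HlBack? 6F 3F = no λ ()
HlBack? 6F 4F = yes e75
HlBack? 6F (suc (suc (suc (suc (suc _))))) = no λ ()

AllPairs-tabulate⁻ : {A : Set} {R : A → A → Set} {n : ℕ} {f : Fin n → A} → AllPairs R (tabulate f) →
  ∀ {i j} → toℕ i < toℕ j → R (f i) (f j)
AllPairs-tabulate⁻ {n = suc n} (r ∷ rs) {zero} {suc j} l = All.lookup r (∈-tabulate⁺ j)
AllPairs-tabulate⁻ {n = suc n} (r ∷ rs) {suc i} {suc j} l = AllPairs-tabulate⁻ rs (s≤s⁻¹ l)

module Stars {V : Set} (b : V → V → Bool) (b-anti : ∀ x y → x ≢ y → b x y ≡ not (b y x)) (b-irr : ∀ x → b x x ≡ false) where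
  open Tournament b b-anti
  open Structure b b-anti
  open Hosts b b-anti

  module InHost {X : List V} {M N L D : ℕ} (H : Host X odd M N (2 * L) D) where
    open Host H

    InRange : Slot → Set
    InRange (i , u) = i < M × u < N

    _at_ : V → Slot → Set
    x at (i , u) = (i < M × u < N) × x ∈ Z i u

    size : Slot → (V → Bool) → ℕ
    size (i , u) P = # P (Z i u)

    full : Slot → ℕ
    full (i , u) = length (Z i u)

    Back : Slot → Slot → V → V → Bool
    Back (i , _) (j , _) = back i j

    Linked : Slot → Slot → Set
    Linked (i , _) (j , _) = i ≢ j × ¬ (odd i ≡ true × odd j ≡ true)

    has : Slot → Slot → (V → Bool) → V → Bool
    has σ τ@(j , v) Q x = any (λ y → Q y ∧ Back σ τ x y) (Z j v)

    -- The vertices satisfying `P` without a back neighbour in `Q` have no back edge to `Q` at all,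
    -- so by `dense` they are fewer than a fraction 1/D. As 2c ≤ D, this is at most half of what `P`
    -- guarantees.
    has-nice : ∀ {σ τ} → InRange σ → InRange τ → Linked σ τ → (P Q : V → Bool) → ∀ c →
      full σ ≤ c * size σ P → full τ ≤ D * size τ Q → 2 * c ≤ D → full σ ≤ 2 * c * size σ (λ x → P x ∧ has σ τ Q x)
    has-nice {σ@(i , u)} {τ@(j , v)} (p , r) (q , w) (n , k) P Q c hP hQ cD with full σ ≤? D * size σ (λ x → P x ∧ not (has σ τ Q x))
    ... | yes most = ⊥-elim (
            let x , y , x∈ , e , y∈ , Qy , bk = dense n p q r w k (λ x → P x ∧ not (has σ τ Q x)) Q most hQ
            in ⊥-true (any-true⁺ (λ y → Q y ∧ back i j x y) y∈ (trans (cong (_∧ back i j x y) Qy) bk)) (not-true (proj₂ (∧-true {P x} e))))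
    ... | no few = +-cancelʳ-≤ (full σ) _ _ (begin
            full σ + full σ                       ≡⟨ cong (full σ +_) (sym (+-identityʳ (full σ))) ⟩
            2 * full σ                            ≤⟨ *-monoʳ-≤ 2 hP ⟩
            2 * (c * size σ P)                    ≡⟨ cong (λ k → 2 * (c * k)) (#-split P (has σ τ Q) (Z i u)) ⟩
            2 * (c * (α + β))                     ≡⟨ expand c α β ⟩
            2 * c * α + 2 * c * β                 ≤⟨ +-monoʳ-≤ (2 * c * α) (≤-trans (*-monoˡ-≤ β cD) (<⇒≤ (≰⇒> few))) ⟩
            2 * c * α + full σ                    ∎)
      where
      open ≤-Reasoning
      α = size σ (λ x → P x ∧ has σ τ Q x)
      β = size σ (λ x → P x ∧ not (has σ τ Q x))
      expand : ∀ c α β → 2 * (c * (α + β)) ≡ 2 * c * α + 2 * c * β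
      expand = solve-∀

    -- Each target halves the guaranteed density of candidates for the centre, whence the power of
    -- 2. The leaves are read off once the centre is fixed, so no relation among them is obtained.
    star : {A : Set} (τ : A → Slot) (Q : A → V → Bool) {σ : Slot} → InRange σ → (ts : List A) →
      (∀ a → a ∈ ts → InRange (τ a) × Linked σ (τ a) × full (τ a) ≤ D * size (τ a) (Q a)) →
      ∀ (P : V → Bool) c → full σ ≤ c * size σ P → c * 2 ^ length ts ≤ D →
      ∃ λ x → x at σ × P x ≡ true × (∀ a → a ∈ ts → ∃ λ y → y at τ a × Q a y ≡ true × Back σ (τ a) x y ≡ true)
    star τ Q {i , u} (p , q) [] tgt P c hP cD =
      let x , x∈ , Px = #-witness P (Z i u) (*-cancelˡ-< c 0 _ (≤-trans (≤-reflexive (cong suc (*-zeroʳ c))) (≤-trans (Z-pos p q) hP)))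
      in x , ((p , q) , x∈) , Px , λ _ ()
    star τ Q {σ} rσ (a ∷ ts) tgt P c hP cD =
      let rτ , lk , hQ = tgt a (here refl)
          x , xσ , e , nb = star τ Q rσ ts (λ a' m → tgt a' (there m)) (λ x → P x ∧ has σ (τ a) (Q a) x) (2 * c)
                              (has-nice rσ rτ lk P (Q a) c hP hQ (≤-trans (≤-trans (≤-reflexive (sym (*-identityʳ (2 * c)))) (*-monoʳ-≤ (2 * c) (m^n>0 2 (length ts)))) cD')) cD'
          Px , hx = ∧-true e
          y , y∈ , e' = any-true⁻ _ (Z (proj₁ (τ a)) (proj₂ (τ a))) hx
          Qy , bk = ∧-true e'
      in x , xσ , Px , λ { a' (here refl) → y , (rτ , y∈) , Qy , bk ; a' (there m) → nb a' m }
      where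
      shuffle : ∀ c k → 2 * c * k ≡ c * (2 * k)
      shuffle = solve-∀
      cD' : 2 * c * 2 ^ length ts ≤ D
      cD' = ≤-trans (≤-reflexive (shuffle c (2 ^ length ts))) cD

    Fwd : ℕ → V → ℕ → V → Set
    Fwd i x j y = (i < j → x ⟶ y) × (j < i → y ⟶ x)

    Chosen : Set
    Chosen = Slot × V

    Valid : Chosen → Set
    Valid (σ , x) = x at σ

    Clears : ℕ → V → Chosen → Set
    Clears j y ((i , _) , x) = Fwd i x j y

    private
      -- Two vertices of one block do not constrain each other here: where such an edge matters, the
      -- block is transitive and `forward` decides it.
      blocked : ℕ → Chosen → V → Bool
      blocked j ((i , _) , x) y = if i ≡ᵇ j then false else back i j x y

    clear : List Chosen → ℕ → V → Bool
    clear sel j y = not (any (λ p → p y) (map (blocked j) sel))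

    -- This fixes the smoothness parameter 2 * L: up to L chosen vertices each forbid at most a
    -- fraction 1/(2L) of a slot.
    clear-half : ∀ {sel} → All Valid sel → length sel ≤ L → ∀ τ → InRange τ → full τ ≤ 2 * size τ (clear sel (proj₁ τ))
    clear-half {sel} val len (j , v) (q , w) = avoid-half (Z j v) L (map (blocked j) sel) (≤-trans (≤-reflexive (length-map (blocked j) sel)) len)
      λ p m → rare p (∈-map⁻ (blocked j) m)
      where
      rare : ∀ p → (∃ λ s → s ∈ sel × p ≡ blocked j s) → 2 * L * # p (Z j v) ≤ length (Z j v)
      rare p ((((i , u) , x) , s∈ , refl)) with i ≡ᵇ j in eq
      ... | true = ≤-trans (≤-reflexive (trans (cong (2 * L *_) (#-false (Z j v))) (*-zeroʳ (2 * L)))) z≤n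
      ... | false = let (p , r) , x∈ = All.lookup val s∈ in smooth (λ e → subst T eq (≡⇒≡ᵇ i j e)) p q r w x∈

    clear-fwd : ∀ {sel} → All Valid sel → ∀ {j v y} → y at (j , v) → clear sel j y ≡ true → All (Clears j y) sel
    clear-fwd {sel} val {j} {v} {y} ((q , w) , y∈) e = All.tabulate λ {s} m → fwd s (All.lookup val m) (any-false (not-true e) (∈-map⁺ (blocked j) m))
      where
      fwd : ∀ s → Valid s → blocked j s y ≡ false → Clears j y s
      fwd ((i , u) , x) ((p , r) , x∈) nb with i ≡ᵇ j in eq
      ... | true rewrite ≡ᵇ⇒≡ i j (subst T (sym eq) _) = (λ l → ⊥-elim (<-irrefl refl l)) , (λ l → ⊥-elim (<-irrefl refl l))
      ... | false = (λ l → flip (neq ∘ sym) (trans (sym (back-< x y l)) nb)) , (λ l → flip neq (trans (sym (back-> x y l)) nb))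
        where
        neq : x ≢ y
        neq = apart (λ e → subst T eq (≡⇒≡ᵇ i j e)) p q r w x∈ y∈

    clear-star : {A : Set} (τ : A → Slot) {sel : List Chosen} → All Valid sel → length sel ≤ L → {σ : Slot} → InRange σ → (ts : List A) →
      (∀ a → a ∈ ts → InRange (τ a) × Linked σ (τ a)) → 2 * 2 ^ length ts ≤ D →
      ∃ λ x → x at σ × All (Clears (proj₁ σ) x) sel ×
        (∀ a → a ∈ ts → ∃ λ y → y at τ a × All (Clears (proj₁ (τ a)) y) sel × Back σ (τ a) x y ≡ true)
    clear-star τ {sel} val len {σ} rσ ts tgt hD =
      let x , xσ , e , nb = star τ (λ a → clear sel (proj₁ (τ a))) rσ ts
                              (λ a m → let rτ , lk = tgt a m in rτ , lk ,
                                ≤-trans (clear-half val len (τ a) rτ) (*-monoˡ-≤ (size (τ a) (clear sel (proj₁ (τ a)))) (≤-trans (*-monoʳ-≤ 2 (m^n>0 2 (length ts))) hD)))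
                              (clear sel (proj₁ σ)) 2 (clear-half val len σ rσ) hD
      in x , xσ , clear-fwd val xσ e , λ a m → let y , yτ , e' , bk = nb a m in y , yτ , clear-fwd val yτ e' , bk

    Edge : List Chosen → Slot → Slot → Set
    Edge sel σ τ = ∃ λ x → ∃ λ y → x at σ × y at τ × All (Clears (proj₁ σ) x) sel × All (Clears (proj₁ τ) y) sel × Back σ τ x y ≡ true

    clear-edge : ∀ {sel} → All Valid sel → length sel ≤ L → ∀ {σ τ} → InRange σ → InRange τ → Linked σ τ → 4 ≤ D → Edge sel σ τ
    clear-edge val len {σ} {τ} rσ rτ lk hD =
      let x , xσ , cx , nb = clear-star (λ τ → τ) val len rσ (τ ∷ []) (λ { τ (here refl) → rτ , lk }) hD
          y , yτ , cy , bk = nb τ (here refl)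
      in x , y , xσ , yτ , cx , cy , bk

    Cherry : List Chosen → Slot → Slot → Slot → Set
    Cherry sel σ τ υ = ∃ λ x → ∃ λ y → ∃ λ z → x at σ × y at τ × z at υ × All (Clears (proj₁ σ) x) sel ×
      All (Clears (proj₁ τ) y) sel × All (Clears (proj₁ υ) z) sel × Back σ τ x y ≡ true × Back σ υ x z ≡ true

    clear-cherry : ∀ {sel} → All Valid sel → length sel ≤ L → ∀ {σ τ υ} → InRange σ → InRange τ → InRange υ →
      Linked σ τ → Linked σ υ → 8 ≤ D → Cherry sel σ τ υ
    clear-cherry val len {σ} {τ} {υ} rσ rτ rυ lk lk' hD =
      let x , xσ , cx , nb = clear-star (λ τ → τ) val len rσ (τ ∷ υ ∷ []) (λ { _ (here refl) → rτ , lk ; _ (there (here refl)) → rυ , lk' }) hD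
          y , yτ , cy , bk = nb τ (here refl)
          z , zυ , cz , bk' = nb υ (there (here refl))
      in x , y , z , xσ , yτ , zυ , cx , cy , cz , bk , bk'

    -- Copies of H_l in a host

    Oriented : Bool → V → V → Set
    Oriented true x y = x ⟶ y
    Oriented false x y = y ⟶ x

    -- The order of the vertices is that of H_l, while the blocks may come in another order, as they
    -- do in a copy built from a triangle. For attaching G only two facts about blocks matter: where
    -- h₇ lies, and that the other six lie before `lim`.
    record HlCopy (q lim : ℕ) : Set where
      field
        x : Fin 7 → V
        σ : Fin 7 → Slot
        placed : ∀ i → x i at σ i
        last : proj₁ (σ 6F) ≡ q
        early : ∀ i → i ≢ 6F → proj₁ (σ i) < lim
        copy : ∀ i j → toℕ i < toℕ j → Oriented (not (does (HlBack? j i))) (x i) (x j)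

    module _ {q₁ q₂ : ℕ} (12<q₁ : 12 < q₁) (q₁<q₂ : q₁ < q₂) (q₂<M : q₂ < M) (3≤N : 3 ≤ N) (5≤L : 5 ≤ L) (8≤D : 8 ≤ D)
             (q₁-even : odd q₁ ≡ false) (q₂-even : odd q₂ ≡ false) where

      private
        12<q₂ : 12 < q₂
        12<q₂ = <-trans 12<q₁ q₁<q₂

        small : ∀ i → T (i <ᵇ 13) → i < M
        small i e = <-trans (≤-<-trans (s≤s⁻¹ (<ᵇ⇒< i 13 e)) 12<q₂) q₂<M
        0<N : 0 < N
        0<N = ≤-trans (s≤s z≤n) 3≤N

      -- A triangle of back edges x < y < z plays the roles of h₂, h₁, h₆: relative to the order h₂ h₄ h₁ h₅ h₃ h₆ h₇
      -- the only other back edges of H_l are h₃h₄ and h₇h₅.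
      triangle : ∀ {i j k u v w} e {x y z} → odd e ≡ false → i < e → e < j → j < 8 → 10 < k → k ≤ q₁ →
        x at (i , u) → y at (j , v) → z at (k , w) → y ⟶ x → z ⟶ x → z ⟶ y → HlCopy q₂ (suc q₁)
      triangle {i} {j} {k} {u} {v} {w} e {x} {y} {z} e-even i<e e<j j<8 10<k k≤q₁ xσ yσ zσ y⟶x z⟶x z⟶y = build
        where
        sel₁ : List Chosen
        sel₁ = ((i , u) , x) ∷ ((j , v) , y) ∷ ((k , w) , z) ∷ []
        val₁ : All Valid sel₁
        val₁ = xσ ∷ yσ ∷ zσ ∷ []
        e<M : e < M
        e<M = <-trans e<j (proj₁ (proj₁ yσ))
        8<10 : 8 < 10
        8<10 = <ᵇ⇒< 8 10 _
        e<10 : e < 10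
        e<10 = <-trans (<-trans e<j j<8) 8<10
        sel₂ : V → V → List Chosen
        sel₂ h₃ h₄ = ((10 , 0) , h₃) ∷ ((e , 0) , h₄) ∷ sel₁
        step₂ : ∀ {h₃ h₄} → Edge (sel₂ h₃ h₄) (8 , 0) (q₂ , 0) → h₃ at (10 , 0) → h₄ at (e , 0) →
          All (Clears 10 h₃) sel₁ → All (Clears e h₄) sel₁ → h₃ ⟶ h₄ → HlCopy q₂ (suc q₁)
        step₂ {h₃} {h₄} (h₅ , h₇ , h₅σ , h₇σ , (h₃-h₅ ∷ h₄-h₅ ∷ x-h₅ ∷ y-h₅ ∷ z-h₅ ∷ []) , (h₃-h₇ ∷ h₄-h₇ ∷ x-h₇ ∷ y-h₇ ∷ z-h₇ ∷ []) , bk₂)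
          h₃σ h₄σ (x-h₃ ∷ y-h₃ ∷ z-h₃ ∷ []) (x-h₄ ∷ y-h₄ ∷ z-h₄ ∷ []) h₃⟶h₄ = record
          { x = X7 ; σ = S7 ; placed = P7 ; last = refl ; early = E7
          ; copy = λ i j l → AllPairs-tabulate⁻ {R = λ i j → Oriented (not (does (HlBack? j i))) (X7 i) (X7 j)} {f = λ i → i} facts l }
          where
          i<8 = <-trans (<-trans i<e e<j) j<8
          e<8 = <-trans e<j j<8
          8<k = <-trans 8<10 10<k
          k<q₂ = ≤-<-trans k≤q₁ q₁<q₂
          10<q₂ = <-trans 10<k k<q₂
          X7 : Fin 7 → V
          X7 0F = y
          X7 1F = x
          X7 2F = h₃
          X7 3F = h₄
          X7 4F = h₅
          X7 5F = z
          X7 6F = h₇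
          S7 : Fin 7 → Slot
          S7 0F = j , v
          S7 1F = i , u
          S7 2F = 10 , 0
          S7 3F = e , 0
          S7 4F = 8 , 0
          S7 5F = k , w
          S7 6F = q₂ , 0
          P7 : ∀ i → X7 i at S7 i
          P7 0F = yσ
          P7 1F = xσ
          P7 2F = h₃σ
          P7 3F = h₄σ
          P7 4F = h₅σ
          P7 5F = zσ
          P7 6F = h₇σ
          10<1+q₁ = s≤s (<⇒≤ (<-≤-trans 10<k k≤q₁))
          E7 : ∀ i → i ≢ 6F → proj₁ (S7 i) < suc q₁
          E7 0F _ = <-trans (<-trans j<8 8<10) 10<1+q₁
          E7 1F _ = <-trans (<-trans i<8 8<10) 10<1+q₁
          E7 2F _ = 10<1+q₁
          E7 3F _ = <-trans e<10 10<1+q₁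
          E7 4F _ = <-trans 8<10 10<1+q₁
          E7 5F _ = s≤s k≤q₁
          E7 6F n = ⊥-elim (n refl)
          facts : AllPairs (λ i j → Oriented (not (does (HlBack? j i))) (X7 i) (X7 j)) (tabulate (λ i → i))
          facts = (y⟶x ∷ proj₁ y-h₃ (<-trans j<8 8<10) ∷ proj₂ y-h₄ e<j ∷ proj₁ y-h₅ j<8 ∷ z⟶y ∷ proj₁ y-h₇ (<-trans (<-trans j<8 8<10) 10<q₂) ∷ [])
            ∷ (proj₁ x-h₃ (<-trans i<8 8<10) ∷ proj₁ x-h₄ i<e ∷ proj₁ x-h₅ i<8 ∷ z⟶x ∷ proj₁ x-h₇ (<-trans (<-trans i<8 8<10) 10<q₂) ∷ [])
            ∷ (h₃⟶h₄ ∷ proj₂ h₃-h₅ 8<10 ∷ proj₂ z-h₃ 10<k ∷ proj₁ h₃-h₇ 10<q₂ ∷ [])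
            ∷ (proj₁ h₄-h₅ e<8 ∷ proj₂ z-h₄ (<-trans e<8 8<k) ∷ proj₁ h₄-h₇ (<-trans e<10 10<q₂) ∷ [])
            ∷ (proj₂ z-h₅ 8<k ∷ trans (sym (back-< h₅ h₇ (<-trans 8<10 10<q₂))) bk₂ ∷ [])
            ∷ (proj₁ z-h₇ k<q₂ ∷ [])
            ∷ [] ∷ []

        -- In the permuted order h₄ precedes h₃, so the forward edge from h₃ to h₄ in H_l has to be
        -- found as a back edge.
        step₁ : Edge sel₁ (10 , 0) (e , 0) → HlCopy q₂ (suc q₁)
        step₁ (h₃ , h₄ , h₃σ , h₄σ , c₃ , c₄ , bk) =
          step₂ (clear-edge {sel₂ h₃ h₄} (h₃σ ∷ h₄σ ∷ val₁) 5≤L {8 , 0} {q₂ , 0} (small 8 _ , 0<N) (q₂<M , 0<N)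
                  ((λ { refl → <⇒≱ 12<q₂ (≤ᵇ⇒≤ 8 12 _) }) , (λ (o , _) → ⊥-true o refl)) (≤-trans (≤ᵇ⇒≤ 4 8 _) 8≤D))
                h₃σ h₄σ c₃ c₄ (trans (sym (back-> h₃ h₄ e<10)) bk)
        build : HlCopy q₂ (suc q₁)
        build = step₁ (clear-edge {sel₁} val₁ (≤-trans (≤ᵇ⇒≤ 3 5 _) 5≤L) {10 , 0} {e , 0} (small 10 _ , 0<N) (e<M , 0<N)
                  ((λ { refl → <-irrefl refl e<10 }) , (λ (o , _) → ⊥-true o refl)) (≤-trans (≤ᵇ⇒≤ 4 8 _) 8≤D))

      -- Both h₂ and h₄ are taken from the transitive block 3, so h₄ → h₁, h₆ → h₁, h₆ → h₂ form an induced path unless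
      -- h₁h₂ or h₄h₆ closes a triangle; the same alternative is met for the path h₃ h₅ h₇.
      hl-copy : HlCopy q₁ 13 ⊎ HlCopy q₂ (suc q₁)
      -- The back path h₄ h₁ h₆ h₂ is found as a star with centre h₁ by restricting the candidates
      -- for h₆ to those that already have a back neighbour for h₂.
      hl-copy = start (star {A = Slot × (V → Bool)} proj₁ proj₂ {0 , 0} (small 0 _ , 0<N) (((3 , 2) , all) ∷ ((12 , 0) , good) ∷ [])
               (λ { a (here refl) → (small 3 _ , 3≤N) , ((λ ()) , λ ()) , nice-all (3 , 2) 1≤D
                  ; a (there (here refl)) → (small 12 _ , 0<N) , ((λ ()) , λ ()) , ≤-trans good-nice (*-monoˡ-≤ (size (12 , 0) good) 2≤D) })
               all 1 (nice-all (0 , 0) ≤-refl) (≤-trans (≤ᵇ⇒≤ 4 8 _) 8≤D))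
        where
        1≤D : 1 ≤ D
        1≤D = ≤-trans (s≤s z≤n) 8≤D
        2≤D : 2 ≤ D
        2≤D = ≤-trans (≤ᵇ⇒≤ 2 8 _) 8≤D
        all good : V → Bool
        all _ = true
        good x = true ∧ has (12 , 0) (3 , 0) all x
        nice-all : ∀ σ {c} → 1 ≤ c → full σ ≤ c * size σ all
        nice-all (i , u) {c} l = ≤-trans (≤-reflexive (sym (#-true (Z i u)))) (≤-trans (≤-reflexive (sym (*-identityˡ _))) (*-monoˡ-≤ _ l))
        good-nice : full (12 , 0) ≤ 2 * size (12 , 0) good
        good-nice = has-nice (small 12 _ , 0<N) (small 3 _ , 0<N) ((λ ()) , λ ()) all all 1 (nice-all (12 , 0) ≤-refl) (nice-all (3 , 0) 1≤D) 2≤D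
        neq : ∀ {i j u v x y} → i ≢ j → x at (i , u) → y at (j , v) → x ≢ y
        neq n ((p , r) , k) ((q , w) , l) = apart n p q r w k l
        sel : V → V → V → V → List Chosen
        sel a h₂ c d = ((0 , 0) , a) ∷ ((3 , 0) , h₂) ∷ ((3 , 2) , c) ∷ ((12 , 0) , d) ∷ []

        finish : ∀ {a h₂ c d h₃ h₅ h₇} → a at (0 , 0) → h₂ at (3 , 0) → c at (3 , 2) → d at (12 , 0) →
          h₃ at (3 , 1) → h₅ at (6 , 0) → h₇ at (q₁ , 0) →
          a ⟶ h₂ → c ⟶ a → d ⟶ a → d ⟶ h₂ → c ⟶ d → h₅ ⟶ h₃ → h₇ ⟶ h₅ → h₃ ⟶ h₇ →
          All (Clears 3 h₃) (sel a h₂ c d) → All (Clears 6 h₅) (sel a h₂ c d) → All (Clears q₁ h₇) (sel a h₂ c d) → HlCopy q₁ 13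
        finish {a} {h₂} {c} {d} {h₃} {h₅} {h₇} aσ bσ cσ dσ h₃σ h₅σ h₇σ a⟶b c⟶a d⟶a d⟶b c⟶d h₅⟶h₃ h₇⟶h₅ h₃⟶h₇
          (a-h₃ ∷ b-h₃ ∷ c-h₃ ∷ d-h₃ ∷ []) (a-h₅ ∷ b-h₅ ∷ c-h₅ ∷ d-h₅ ∷ []) (a-h₇ ∷ b-h₇ ∷ c-h₇ ∷ d-h₇ ∷ []) = record
          { x = X7 ; σ = S7 ; placed = P7 ; last = refl ; early = E7
          ; copy = λ i j l → AllPairs-tabulate⁻ {R = λ i j → Oriented (not (does (HlBack? j i))) (X7 i) (X7 j)} {f = λ i → i} facts l }
          where
          X7 : Fin 7 → V
          X7 0F = a
          X7 1F = h₂
          X7 2F = h₃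
          X7 3F = c
          X7 4F = h₅
          X7 5F = d
          X7 6F = h₇
          S7 : Fin 7 → Slot
          -- The gaps are deliberate: the even blocks 2 and 4 are kept for the h₄ of a triangle, and
          -- 8 and 10 for its h₅ and h₃. Block 3 is transitive and supplies the three pieces for h₂,
          -- h₃, h₄.
          S7 0F = 0 , 0
          S7 1F = 3 , 0
          S7 2F = 3 , 1
          S7 3F = 3 , 2
          S7 4F = 6 , 0
          S7 5F = 12 , 0
          S7 6F = q₁ , 0
          P7 : ∀ i → X7 i at S7 i
          P7 0F = aσ
          P7 1F = bσ
          P7 2F = h₃σ
          P7 3F = cσ
          P7 4F = h₅σ
          P7 5F = dσ
          P7 6F = h₇σ
          E7 : ∀ i → i ≢ 6F → proj₁ (S7 i) < 13
          E7 0F _ = <ᵇ⇒< 0 13 _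
          E7 1F _ = <ᵇ⇒< 3 13 _
          E7 2F _ = <ᵇ⇒< 3 13 _
          E7 3F _ = <ᵇ⇒< 3 13 _
          E7 4F _ = <ᵇ⇒< 6 13 _
          E7 5F _ = <ᵇ⇒< 12 13 _
          E7 6F n = ⊥-elim (n refl)
          facts : AllPairs (λ i j → Oriented (not (does (HlBack? j i))) (X7 i) (X7 j)) (tabulate (λ i → i))
          facts = (a⟶b ∷ proj₁ a-h₃ (<ᵇ⇒< 0 3 _) ∷ c⟶a ∷ proj₁ a-h₅ (<ᵇ⇒< 0 6 _) ∷ d⟶a ∷ proj₁ a-h₇ (<-trans (<ᵇ⇒< 0 12 _) 12<q₁) ∷ [])
            ∷ (forward (small 3 _) (<ᵇ⇒< 0 1 _) (≤-trans (n≤1+n _) 3≤N) refl (proj₂ bσ) (proj₂ h₃σ) ∷ forward (small 3 _) (<ᵇ⇒< 0 2 _) 3≤N refl (proj₂ bσ) (proj₂ cσ)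
                ∷ proj₁ b-h₅ (<ᵇ⇒< 3 6 _) ∷ d⟶b ∷ proj₁ b-h₇ (<-trans (<ᵇ⇒< 3 12 _) 12<q₁) ∷ [])
            ∷ (forward (small 3 _) (<ᵇ⇒< 1 2 _) 3≤N refl (proj₂ h₃σ) (proj₂ cσ) ∷ h₅⟶h₃ ∷ proj₂ d-h₃ (<ᵇ⇒< 3 12 _)
                ∷ h₃⟶h₇ ∷ [])
            ∷ (proj₁ c-h₅ (<ᵇ⇒< 3 6 _) ∷ c⟶d ∷ proj₁ c-h₇ (<-trans (<ᵇ⇒< 3 12 _) 12<q₁) ∷ [])
            ∷ (proj₂ d-h₅ (<ᵇ⇒< 6 12 _) ∷ h₇⟶h₅ ∷ [])
            ∷ (proj₁ d-h₇ 12<q₁ ∷ [])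
            ∷ [] ∷ []

        path-or-triangle : ∀ {a h₂ c d} → a at (0 , 0) → h₂ at (3 , 0) → c at (3 , 2) → d at (12 , 0) →
          a ⟶ h₂ → c ⟶ a → d ⟶ a → d ⟶ h₂ → c ⟶ d → Cherry (sel a h₂ c d) (6 , 0) (3 , 1) (q₁ , 0) → HlCopy q₁ 13 ⊎ HlCopy q₂ (suc q₁)
        path-or-triangle aσ bσ cσ dσ ab ca da db cd (h₅ , h₃ , h₇ , h₅σ , h₃σ , h₇σ , c₅ , c₃ , c₇ , h₅⟶h₃ , bk) = close (b h₇ h₃) refl
          where
          h₇⟶h₅ : h₇ ⟶ h₅
          h₇⟶h₅ = trans (sym (back-< h₅ h₇ (<-trans (<ᵇ⇒< 6 12 _) 12<q₁))) bk
          close : ∀ t → b h₇ h₃ ≡ t → HlCopy q₁ 13 ⊎ HlCopy q₂ (suc q₁)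
          -- Here the vertex found in block `q₁` takes the role of h₆, so a new h₇ has to be found
          -- beyond it, in block `q₂`.
          close true e = inj₂ (triangle 4 refl (<ᵇ⇒< 3 4 _) (<ᵇ⇒< 4 6 _) (<ᵇ⇒< 6 8 _) (<-trans (<ᵇ⇒< 10 12 _) 12<q₁) ≤-refl h₃σ h₅σ h₇σ h₅⟶h₃ e h₇⟶h₅)
          close false e = inj₁ (finish aσ bσ cσ dσ h₃σ h₅σ h₇σ ab ca da db cd h₅⟶h₃ h₇⟶h₅
            (flip (neq (λ { refl → <⇒≱ 12<q₁ (≤ᵇ⇒≤ 3 12 _) }) h₇σ h₃σ) e) c₃ c₅ c₇)

        extend : ∀ {a h₂ c d} → a at (0 , 0) → h₂ at (3 , 0) → c at (3 , 2) → d at (12 , 0) →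
          c ⟶ a → d ⟶ a → d ⟶ h₂ → HlCopy q₁ 13 ⊎ HlCopy q₂ (suc q₁)
        extend {a} {h₂} {c} {d} aσ bσ cσ dσ ca da db = close (b h₂ a) (b d c) refl refl
          where
          close : ∀ t t' → b h₂ a ≡ t → b d c ≡ t' → HlCopy q₁ 13 ⊎ HlCopy q₂ (suc q₁)
          -- A wrong edge between h₂ and h₁ gives the triangle on h₁, h₂, h₆, and one between h₄ and
          -- h₆ the triangle on h₁, h₄, h₆; in both cases block 2 lies between the two earliest
          -- vertices.
          close true _ e _ = inj₂ (triangle 2 refl (<ᵇ⇒< 0 2 _) (<ᵇ⇒< 2 3 _) (<ᵇ⇒< 3 8 _) (<ᵇ⇒< 10 12 _) (<⇒≤ 12<q₁) aσ bσ dσ e da db)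
          close false true _ e = inj₂ (triangle 2 refl (<ᵇ⇒< 0 2 _) (<ᵇ⇒< 2 3 _) (<ᵇ⇒< 3 8 _) (<ᵇ⇒< 10 12 _) (<⇒≤ 12<q₁) aσ cσ dσ ca da e)
          close false false e e' = path-or-triangle aσ bσ cσ dσ (flip (neq (λ ()) bσ aσ) e) ca da db (flip (neq (λ ()) dσ cσ) e')
            (clear-cherry {sel a h₂ c d} (aσ ∷ bσ ∷ cσ ∷ dσ ∷ []) (≤-trans (n≤1+n 4) 5≤L) {6 , 0} {3 , 1} {q₁ , 0}
              (small 6 _ , 0<N) (small 3 _ , ≤-trans (n≤1+n 2) 3≤N) (<-trans q₁<q₂ q₂<M , 0<N)
              ((λ ()) , λ ()) ((λ { refl → <⇒≱ 12<q₁ (≤ᵇ⇒≤ 6 12 _) }) , (λ (o , _) → ⊥-true o refl)) 8≤D)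

        start : (∃ λ a → a at (0 , 0) × true ≡ true × (∀ t → t ∈ ((3 , 2) , all) ∷ ((12 , 0) , good) ∷ [] →
          ∃ λ y → y at proj₁ t × proj₂ t y ≡ true × Back (0 , 0) (proj₁ t) a y ≡ true)) → HlCopy q₁ 13 ⊎ HlCopy q₂ (suc q₁)
        start (a , aσ , _ , nb) =
          let c , cσ , _ , ca = nb ((3 , 2) , all) (here refl)
              d , dσ , e , da = nb ((12 , 0) , good) (there (here refl))
              h₂ , h₂∈ , db = any-true⁻ (λ y → true ∧ back 12 3 d y) (Z 3 0) e
          in extend aσ ((small 3 _ , 0<N) , h₂∈) cσ dσ ca da db

-- Placing a galaxy

odd-2* : ∀ n k → odd n ≡ false → odd (n + 2 * k) ≡ false
odd-2* n zero e = trans (cong odd (+-identityʳ n)) e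
odd-2* n (suc k) e = trans (cong odd (shift n k)) (trans (cong (not ∘ not) (odd-2* n k e)) refl)
  where
  shift : ∀ n k → n + 2 * suc k ≡ suc (suc (n + 2 * k))
  shift = solve-∀

-- Totality names one direction for each pair and asymmetry refutes the other, so adjacency can be
-- treated as Boolean.
decidable : {V : Set} {adj : V → V → Set} → (∀ x y → Dec (x ≡ y)) → IsTournament adj → ∀ x y → Dec (adj x y)
decidable _≟_ (irr , tot , asym) x y with x ≟ y
... | yes refl = no (irr x)
... | no n with tot x y n
...   | inj₁ e = yes e
...   | inj₂ e = no (λ e' → asym x y e' e)

module Galaxy {r : ℕ} {adjG : Fin r → Fin r → Set} (tG : IsTournament adjG) (g : GalaxyOrdering adjG) (s : ℕ) (split : SplitOK g s) where
  open GalaxyOrdering g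

  adj? : ∀ u w → Dec (adjG u w)
  adj? = decidable Fin._≟_ tG

  BEdge? : ∀ u w → Dec (BEdge adjG u w)
  BEdge? u w = (adj? u w ×-dec (w Fin.<? u)) ⊎-dec (adj? w u ×-dec (u Fin.<? w))

  BEdge-sym : ∀ {u w} → BEdge adjG u w → BEdge adjG w u
  BEdge-sym (inj₁ e) = inj₂ e
  BEdge-sym (inj₂ e) = inj₁ e

  Conn-trans : ∀ {u v w} → Conn adjG u v → Conn adjG v w → Conn adjG u w
  Conn-trans here d = d
  Conn-trans (step e c) d = step e (Conn-trans c d)

  Conn-sym : ∀ {u v} → Conn adjG u v → Conn adjG v u
  Conn-sym here = here
  Conn-sym (step e c) = Conn-trans (Conn-sym c) (step (BEdge-sym e) here)

  cen-cen : ∀ u → cen (cen u) ≡ cen u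
  cen-cen u = sym (cen-const u (cen u) (cen-comp u))

  same-cen : ∀ {u w} → cen u ≡ cen w → Conn adjG u w
  same-cen {u} {w} e = Conn-trans (cen-comp u) (subst (λ c → Conn adjG c w) (sym e) (Conn-sym (cen-comp w)))

  edge-cen : ∀ {u w} → BEdge adjG u w → cen u ≡ cen w
  edge-cen e = cen-const _ _ (step e here)

  -- The edge is required because an isolated vertex is also its own `cen`; it needs no large block
  -- and is placed with the leaves.
  Center : Fin r → Set
  Center u = cen u ≡ u × ∃ λ w → BEdge adjG u w

  Center? : ∀ u → Dec (Center u)
  Center? u = (cen u Fin.≟ u) ×-dec Fin.any? (BEdge? u)

  Leaf : Fin r → Fin r → Set
  Leaf c l = cen l ≡ c × l ≢ c

  leaf-star : ∀ {c l} → Leaf c l →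
    (∀ u w → Conn adjG l u → Conn adjG l w → BEdge adjG u w ⇔ (u ≢ w × (u ≡ cen l ⊎ w ≡ cen l))) ×
    ((∀ u → Conn adjG l u → u F.≤ cen l) ⊎ (∀ u → Conn adjG l u → cen l F.≤ u))
  leaf-star {c} {l} (refl , n) with components l
  ... | inj₂ st = st
  ... | inj₁ iso = ⊥-elim (first (cen-comp l) n)
    where
    first : ∀ {v} → Conn adjG l v → l ≢ v → ⊥
    first here n = n refl
    first (step e _) n = iso _ e

  leaf-edge : ∀ {c l} → Leaf c l → BEdge adjG c l
  leaf-edge {c} {l} lf@(refl , n) = Equivalence.from (proj₁ (leaf-star lf) c l (cen-comp l) here) (n ∘ sym , inj₁ refl)

  leaf-leaf : ∀ {c l l'} → Leaf c l → Leaf c l' → ¬ BEdge adjG l l'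
  leaf-leaf {c} {l} {l'} lf@(refl , n) (e , n') be with Equivalence.to (proj₁ (leaf-star lf) l l' here (same-cen (sym e))) be
  ... | _ , inj₁ h = n h
  ... | _ , inj₂ h = n' h

  leaf-center : ∀ {c l} → Leaf c l → Center c
  leaf-center {c} {l} lf@(refl , n) = cen-cen l , l , leaf-edge lf

  leaf-not-center : ∀ {c l} → Leaf c l → ¬ Center l
  leaf-not-center (refl , n) (e , _) = n (sym e)

  -- Positions relative to h₇, which occupies position s.
  π : Fin r → ℕ
  π u = if does (suc (toℕ u) ≤? s) then toℕ u else suc (toℕ u)

  π-cases : ∀ u → (toℕ u < s × π u ≡ toℕ u) ⊎ (s ≤ toℕ u × π u ≡ suc (toℕ u))
  π-cases u with suc (toℕ u) ≤? s
  ... | yes l = inj₁ (l , cong (λ b → if b then toℕ u else suc (toℕ u)) (dec-true (suc (toℕ u) ≤? s) l))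
  ... | no l = inj₂ (≮⇒≥ l , cong (λ b → if b then toℕ u else suc (toℕ u)) (dec-false (suc (toℕ u) ≤? s) l))

  π-mono : ∀ {u w} → toℕ u < toℕ w → π u < π w
  π-mono {u} {w} l with π-cases u | π-cases w
  ... | inj₁ (a , e) | inj₁ (c , e') rewrite e | e' = l
  ... | inj₁ (a , e) | inj₂ (c , e') rewrite e | e' = m<n⇒m<1+n l
  ... | inj₂ (a , e) | inj₁ (c , e') = ⊥-elim (<⇒≱ (<-trans l c) a)
  ... | inj₂ (a , e) | inj₂ (c , e') rewrite e | e' = s≤s l

  π-reflects : ∀ {u w} → π u < π w → toℕ u < toℕ w
  π-reflects {u} {w} l with <-cmp (toℕ u) (toℕ w)
  ... | tri< lt _ _ = lt
  ... | tri≈ _ e _ rewrite Fin.toℕ-injective e = ⊥-elim (<-irrefl refl l)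
  ... | tri> _ _ gt = ⊥-elim (<-asym l (π-mono gt))

  π-≤r : ∀ u → π u ≤ r
  π-≤r u with π-cases u
  ... | inj₁ (_ , e) rewrite e = <⇒≤ (Fin.toℕ<n u)
  ... | inj₂ (_ , e) rewrite e = Fin.toℕ<n u

  -- The positions that need a large block: back edges between two transitive blocks cannot be
  -- produced, so a centre, like h₇, must not lie in one.
  Solid : ℕ → Set
  Solid x = x ≡ s ⊎ ∃ λ u → π u ≡ x × Center u

  Solid? : ∀ x → Dec (Solid x)
  Solid? x = (x ≟ s) ⊎-dec Fin.any? (λ u → (π u ≟ x) ×-dec Center? u)

  -- One more than the last solid position before x, or 0 if there is none.
  last : ℕ → ℕ
  last zero = 0
  last (suc x) = if does (Solid? x) then suc x else last x

  last-≤ : ∀ x → last x ≤ x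
  last-≤ zero = z≤n
  last-≤ (suc x) with does (Solid? x)
  ... | true = ≤-refl
  ... | false = m≤n⇒m≤1+n (last-≤ x)

  last-step : ∀ x → last x ≤ last (suc x)
  last-step x with does (Solid? x)
  ... | true = m≤n⇒m≤1+n (last-≤ x)
  ... | false = ≤-refl

  last-mono : ∀ {x y} → x ≤ y → last x ≤ last y
  last-mono {x} {y} l with m≤n⇒∃[o]m+o≡n l
  ... | o , refl = go o
    where
    go : ∀ o → last x ≤ last (x + o)
    go zero = ≤-reflexive (cong last (sym (+-identityʳ x)))
    go (suc o) = ≤-trans (go o) (≤-trans (last-step (x + o)) (≤-reflexive (cong last (sym (+-suc x o)))))

  last-solid : ∀ {x y} → Solid x → x < y → suc x ≤ last y
  last-solid {x} {y} so l = ≤-trans (≤-reflexive (cong (λ b → if b then suc x else last x) (sym (dec-true (Solid? x) so)))) (last-mono l)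

  last-gap : ∀ {x y} → x ≤ y → (∀ z → x ≤ z → z < y → ¬ Solid z) → last x ≡ last y
  last-gap {x} l gap with m≤n⇒∃[o]m+o≡n l
  ... | o , refl = go o gap
    where
    go : ∀ o → (∀ z → x ≤ z → z < x + o → ¬ Solid z) → last x ≡ last (x + o)
    go zero gap = cong last (sym (+-identityʳ x))
    go (suc o) gap = trans (go o (λ z p q → gap z p (<-≤-trans q (+-monoʳ-≤ x (n≤1+n o)))))
      (trans (cong (λ b → if b then suc (x + o) else last (x + o)) (sym (dec-false (Solid? (x + o)) (gap (x + o) (m≤m+n x o) (≤-reflexive (sym (+-suc x o)))))))
             (cong last (sym (+-suc x o))))

  -- Between two leaves of a star there is no solid position: not h₇, by the split condition; not
  -- the centre of another star, by `noncrossing`; and not their own centre, which is an extreme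
  -- vertex of a left or right star.
  leaves-together : ∀ {c l l'} → Leaf c l → Leaf c l' → toℕ l < toℕ l' → last (π l) ≡ last (π l')
  leaves-together {c} {l} {l'} lf@(refl , n) lf'@(e , n') lt = last-gap (<⇒≤ (π-mono lt)) gap
    where
    conn : Conn adjG l l'
    conn = same-cen (sym e)
    gap : ∀ z → π l ≤ z → z < π l' → ¬ Solid z
    gap z p q (inj₁ refl) with π-cases l | π-cases l'
    ... | inj₁ (a , _) | inj₂ (c , _) = split l l' conn n n' a c
    ... | inj₂ (a , e) | _ rewrite e = <⇒≱ p a
    ... | inj₁ _ | inj₁ (a , e) rewrite e = <⇒≱ q (<⇒≤ a)
    gap z p q (inj₂ (v , refl , cv , nb)) with toℕ v ≟ toℕ l
    ... | yes e = leaf-not-center lf (subst Center (Fin.toℕ-injective e) (cv , nb))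
    ... | no v≢l = between (π-reflects q)
      where
      l<v : toℕ l < toℕ v
      l<v = ≤∧≢⇒< (≮⇒≥ λ v<l → <⇒≱ (π-mono v<l) p) (v≢l ∘ sym)
      between : toℕ v < toℕ l' → ⊥
      between v<l' with cen v Fin.≟ cen l
      ... | yes e' = [ (λ right → <⇒≱ (subst (λ k → toℕ k < toℕ l') (trans (sym cv) e') v<l') (right l' conn))
                     , (λ left → <⇒≱ (subst (λ k → toℕ l < toℕ k) (trans (sym cv) e') l<v) (left l here)) ]′ (proj₂ (leaf-star lf))
      ... | no d = noncrossing v l l' nb (d ∘ cen-const v l) conn n n'
                     (subst (λ k → toℕ l < toℕ k) (sym cv) l<v , subst (λ k → toℕ k < toℕ l') (sym cv) v<l')

  -- Blocks and pieces for the vertices of the galaxy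

  module Layout (off : ℕ) (off-even : odd off ≡ false) where

    -- A centre gets a large block of its own.  All other vertices between two consecutive solid positions share one
    -- transitive block, where the leaves of a star are joined by forward edges automatically.
    solidBlock hollowBlock : ℕ → ℕ
    solidBlock x = off + 2 * suc x
    hollowBlock x = off + suc (2 * last x)

    solidBlock-even : ∀ x → odd (solidBlock x) ≡ false
    solidBlock-even x = odd-2* off (suc x) off-even

    hollowBlock-odd : ∀ x → odd (hollowBlock x) ≡ true
    hollowBlock-odd x = trans (cong odd (+-suc off (2 * last x))) (cong not (odd-2* off (last x) off-even))

    slot : Fin r → Slot
    slot u = if does (Center? u) then (solidBlock (π u) , 0) else (hollowBlock (π u) , π u)

    data SlotView (u : Fin r) : Slot → Set where
      solid  : Center u → SlotView u (solidBlock (π u) , 0)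
      hollow : ¬ Center u → SlotView u (hollowBlock (π u) , π u)

    view : ∀ u → SlotView u (slot u)
    view u with Center? u
    ... | yes c = subst (SlotView u) (cong (λ b → if b then (solidBlock (π u) , 0) else (hollowBlock (π u) , π u)) (sym (dec-true (Center? u) c))) (solid c)
    ... | no c = subst (SlotView u) (cong (λ b → if b then (solidBlock (π u) , 0) else (hollowBlock (π u) , π u)) (sym (dec-false (Center? u) c))) (hollow c)

    Before : Slot → Slot → Set
    Before (i , u) (j , v) = i < j ⊎ (i ≡ j × odd i ≡ true × u < v)

    solid<solid : ∀ {x y} → x < y → solidBlock x < solidBlock y
    solid<solid l = +-monoʳ-< off (*-monoʳ-< 2 (s≤s l))

    hollow<solid : ∀ {x y} → x ≤ y → hollowBlock x < solidBlock y
    hollow<solid {x} {y} l = +-monoʳ-< off (≤-trans (≤-reflexive (double (last x))) (*-monoʳ-≤ 2 (s≤s (≤-trans (last-≤ x) l))))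
      where
      double : ∀ k → suc (suc (2 * k)) ≡ 2 * suc k
      double = solve-∀

    solid<hollow : ∀ {x y} → Solid x → x < y → solidBlock x < hollowBlock y
    solid<hollow so l = +-monoʳ-< off (s≤s (*-monoʳ-≤ 2 (last-solid so l)))

    before : ∀ {u w} → toℕ u < toℕ w → Before (slot u) (slot w)
    before {u} {w} l = go (view u) (view w)
      where
      go : ∀ {σ τ} → SlotView u σ → SlotView w τ → Before σ τ
      go (solid c) (solid c') = inj₁ (solid<solid (π-mono l))
      go (solid c) (hollow c') = inj₁ (solid<hollow (inj₂ (u , refl , c)) (π-mono l))
      go (hollow c) (solid c') = inj₁ (hollow<solid (<⇒≤ (π-mono l)))
      go (hollow c) (hollow c') with m≤n⇒m<n∨m≡n (last-mono (<⇒≤ (π-mono l)))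
      ... | inj₁ lt = inj₁ (+-monoʳ-< off (s≤s (*-monoʳ-< 2 lt)))
      ... | inj₂ e = inj₂ (cong (λ k → off + suc (2 * k)) e , hollowBlock-odd (π u) , π-mono l)

    slot-above : ∀ u → off < proj₁ (slot u)
    slot-above u = go (view u)
      where
      go : ∀ {σ} → SlotView u σ → off < proj₁ σ
      go (solid c) = m<m+n off (s≤s z≤n)
      go (hollow c) = m<m+n off (s≤s z≤n)

    slot-below : ∀ u → proj₁ (slot u) < off + 2 * suc (suc r)
    slot-below u = go (view u)
      where
      go : ∀ {σ} → SlotView u σ → proj₁ σ < off + 2 * suc (suc r)
      go (solid c) = +-monoʳ-< off (*-monoʳ-< 2 (s≤s (s≤s (π-≤r u))))
      go (hollow c) = hollow<solid (≤-trans (π-≤r u) (n≤1+n r))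

    slot-piece : ∀ u → proj₂ (slot u) ≤ r
    slot-piece u = go (view u)
      where
      go : ∀ {σ} → SlotView u σ → proj₂ σ ≤ r
      go (solid c) = z≤n
      go (hollow c) = π-≤r u

    slot-h₇ : ∀ u → (π u < s → proj₁ (slot u) < solidBlock s) × (s < π u → solidBlock s < proj₁ (slot u))
    slot-h₇ u = go (view u)
      where
      go : ∀ {σ} → SlotView u σ → (π u < s → proj₁ σ < solidBlock s) × (s < π u → solidBlock s < proj₁ σ)
      go (solid c) = solid<solid , solid<solid
      go (hollow c) = hollow<solid ∘ <⇒≤ , solid<hollow (inj₁ refl)

    center-even : ∀ {c} → Center c → odd (proj₁ (slot c)) ≡ false
    center-even {c} ce = go (view c)
      where
      go : ∀ {σ} → SlotView c σ → odd (proj₁ σ) ≡ false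
      go (solid _) = solidBlock-even (π c)
      go (hollow n) = ⊥-elim (n ce)

    leaf-odd : ∀ {c l} → Leaf c l → odd (proj₁ (slot l)) ≡ true
    leaf-odd {c} {l} lf = go (view l)
      where
      go : ∀ {σ} → SlotView l σ → odd (proj₁ σ) ≡ true
      go (solid ce) = ⊥-elim (leaf-not-center lf ce)
      go (hollow n) = hollowBlock-odd (π l)

    leaves-block : ∀ {c l l'} → Leaf c l → Leaf c l' → toℕ l < toℕ l' → proj₁ (slot l) ≡ proj₁ (slot l')
    leaves-block {c} {l} {l'} lf lf' lt = go (view l) (view l')
      where
      go : ∀ {σ τ} → SlotView l σ → SlotView l' τ → proj₁ σ ≡ proj₁ τ
      go (solid ce) _ = ⊥-elim (leaf-not-center lf ce)
      go _ (solid ce) = ⊥-elim (leaf-not-center lf' ce)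
      go (hollow _) (hollow _) = cong (λ k → off + suc (2 * k)) (leaves-together lf lf' lt)

  -- Embedding the galaxy star by star

  module Place {V : Set} (b : V → V → Bool) (b-anti : ∀ x y → x ≢ y → b x y ≡ not (b y x)) (b-irr : ∀ x → b x x ≡ false)
    {X : List V} {M N L D : ℕ} where
    open Structure b b-anti using (_⟶_)
    open Hosts b b-anti
    open Stars b b-anti b-irr

    module _ (H : Host X odd M N (2 * L) D) (off : ℕ) (off-even : odd off ≡ false) (room : off + 2 * suc (suc r) ≤ M) (r<N : r < N)
             (hD : 2 * 2 ^ r ≤ D) (base : List (Slot × V)) (base-valid : All (InHost.Valid {L = L} H) base) (base-length : length base + r ≤ L)
             (default : V) where
      open Host H
      open InHost {L = L} H
      open Layout off off-even

      slot-range : ∀ u → InRange (slot u)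
      slot-range u = <-≤-trans (slot-below u) room , ≤-<-trans (slot-piece u) r<N

      ordered : ∀ {σ τ x y} → x at σ → y at τ → Before σ τ → (proj₁ σ < proj₁ τ → x ⟶ y) → x ⟶ y
      ordered xσ yτ (inj₁ lt) f = f lt
      ordered ((p , q) , x∈) ((p' , q') , y∈) (inj₂ (refl , o , lt)) f = forward p lt q' o x∈ y∈

      -- Progress is measured by centres: a whole star is placed when the index of its centre is
      -- reached, whether its leaves come earlier or later.
      Done : ℕ → Fin r → Set
      Done t u = toℕ (cen u) < t

      record Partial (t : ℕ) : Set where
        field
          y : Fin r → V
          placed : ∀ u → Done t u → y u at slot u
          cleared : ∀ u → Done t u → All (Clears (proj₁ (slot u)) (y u)) base
          related : ∀ u w → Done t u → Done t w → toℕ u < toℕ w → Oriented (does (adj? u w)) (y u) (y w)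

      no-edge : ∀ {u w} → toℕ u < toℕ w → ¬ BEdge adjG u w → does (adj? u w) ≡ true
      no-edge {u} {w} l n with proj₁ (proj₂ tG) u w (λ { refl → <-irrefl refl l })
      ... | inj₁ e = dec-true (adj? u w) e
      ... | inj₂ e = ⊥-elim (n (inj₂ (e , l)))

      edge : ∀ {u w} → toℕ u < toℕ w → BEdge adjG u w → does (adj? u w) ≡ false
      edge l (inj₁ (_ , gt)) = ⊥-elim (<-asym l gt)
      edge {u} {w} l (inj₂ (e , _)) = dec-false (adj? u w) (λ e' → proj₂ (proj₂ tG) u w e' e)

      module Step {t : ℕ} (t<r : t < r) (part : Partial t) where
        open Partial part

        c : Fin r
        c = fromℕ< t<r

        done-old : ∀ {u} → Done (suc t) u → cen u ≢ c → Done t u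
        done-old {u} d n = ≤∧≢⇒< (s≤s⁻¹ d) (λ e → n (Fin.toℕ-injective (trans e (sym (Fin.toℕ-fromℕ< t<r)))))

        -- A vertex that is not its own centre is a leaf and belongs to the round of its centre.
        skip : cen c ≢ c → Partial (suc t)
        skip n = record { y = y ; placed = λ u d → placed u (old d) ; cleared = λ u d → cleared u (old d)
                        ; related = λ u w d d' → related u w (old d) (old d') }
          where
          old : ∀ {u} → Done (suc t) u → Done t u
          old {u} d = done-old d (λ e → n (trans (cong cen (sym e)) (trans (cen-cen u) e)))

        sel : List Chosen
        sel = base ++ map (λ u → slot u , y u) (filterᵇ (λ u → does (toℕ (cen u) <? t)) (allFin r))

        sel-old : ∀ {u} → Done t u → (slot u , y u) ∈ sel
        sel-old {u} d = ∈-++⁺ʳ base (∈-map⁺ (λ u → slot u , y u) (∈-filterᵇ⁺ _ (allFin r) (∈-allFin u) (dec-true (toℕ (cen u) <? t) d)))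

        does-true : {P : Set} (d : Dec P) → does d ≡ true → P
        does-true (yes p) _ = p

        sel-valid : All Valid sel
        sel-valid = All.++⁺ base-valid (All.map⁺ (All.tabulate λ {u} m → placed u (does-true (toℕ (cen u) <? t) (proj₂ (∈-filterᵇ⁻ _ (allFin r) m)))))

        sel-length : length sel ≤ L
        sel-length = ≤-trans (≤-reflexive (length-++ base)) (≤-trans (+-monoʳ-≤ (length base)
          (≤-trans (≤-reflexive (length-map _ (filterᵇ _ (allFin r)))) (≤-trans (#-≤-length _ (allFin r)) (≤-reflexive (length-tabulate (λ i → i)))))) base-length)

        isLeaf : Fin r → Bool
        isLeaf u = does ((cen u Fin.≟ c) ×-dec (¬? (u Fin.≟ c)))

        leaves : List (Fin r)
        leaves = filterᵇ isLeaf (allFin r)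

        leaf∈ : ∀ {l} → Leaf c l → l ∈ leaves
        leaf∈ {l} lf = ∈-filterᵇ⁺ isLeaf (allFin r) (∈-allFin l) (dec-true ((cen l Fin.≟ c) ×-dec (¬? (l Fin.≟ c))) lf)

        ∈leaf : ∀ {l} → l ∈ leaves → Leaf c l
        ∈leaf {l} m = does-true ((cen l Fin.≟ c) ×-dec (¬? (l Fin.≟ c))) (proj₂ (∈-filterᵇ⁻ isLeaf (allFin r) m))

        leaf-linked : ∀ l → l ∈ leaves → InRange (slot l) × Linked (slot c) (slot l)
        leaf-linked l m = slot-range l , (λ e → ⊥-true (leaf-odd lf) (trans (cong odd (sym e)) even)) , (λ (o , _) → ⊥-true o even)
          where
          lf = ∈leaf m
          even = center-even (leaf-center lf)

        leaves-length : length leaves ≤ r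
        leaves-length = ≤-trans (#-≤-length isLeaf (allFin r)) (≤-reflexive (length-tabulate (λ i → i)))

        StarAt : Set
        StarAt = ∃ λ x → x at slot c × All (Clears (proj₁ (slot c)) x) sel ×
          (∀ l → l ∈ leaves → ∃ λ z → z at slot l × All (Clears (proj₁ (slot l)) z) sel × Back (slot c) (slot l) x z ≡ true)

        -- An isolated vertex is covered too: it has no leaves, and the star consists of its centre
        -- alone.
        starAt : StarAt
        starAt = clear-star slot sel-valid sel-length (slot-range c) leaves leaf-linked
          (≤-trans (*-monoʳ-≤ 2 (^-monoʳ-≤ 2 leaves-length)) hD)

        extend : cen c ≡ c → StarAt → Partial (suc t)
        extend cc (v , vσ , v-clear , nb) = record { y = y' ; placed = placed' ; cleared = cleared' ; related = related' }
          where
          -- Indexing by the image lets the case analysis on a pair of vertices determine both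
          -- images by matching. `old` also covers vertices whose round is still to come.
          data Kind (u : Fin r) : V → Set where
            centre : u ≡ c → Kind u v
            leaf : (lf : Leaf c u) → Kind u (proj₁ (nb u (leaf∈ lf)))
            old : cen u ≢ c → Kind u (y u)

          kind : ∀ u → ∃ (Kind u)
          kind u with u Fin.≟ c | cen u Fin.≟ c
          ... | yes e | _ = _ , centre e
          ... | no n | yes e = _ , leaf (e , n)
          ... | no n | no m = _ , old m

          y' : Fin r → V
          y' u = proj₁ (kind u)

          fresh : ∀ {u z} → Kind u z → cen u ≡ c → z at slot u × All (Clears (proj₁ (slot u)) z) sel
          fresh (centre refl) _ = vσ , v-clear
          fresh {u} (leaf lf) _ = let _ , zσ , cl , _ = nb u (leaf∈ lf) in zσ , cl
          fresh (old n) e = ⊥-elim (n e)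

          stale : ∀ {u z} → Kind u z → cen u ≢ c → z ≡ y u
          stale (centre refl) n = ⊥-elim (n cc)
          stale (leaf (e , _)) n = ⊥-elim (n e)
          stale (old _) n = refl

          placed-kind : ∀ {u z} → Kind u z → Done (suc t) u → z at slot u
          placed-kind {u} k d with cen u Fin.≟ c
          ... | yes e = proj₁ (fresh k e)
          ... | no n rewrite stale k n = placed u (done-old d n)

          placed' : ∀ u → Done (suc t) u → y' u at slot u
          placed' u = placed-kind (proj₂ (kind u))

          cleared-kind : ∀ {u z} → Kind u z → Done (suc t) u → All (Clears (proj₁ (slot u)) z) base
          cleared-kind {u} k d with cen u Fin.≟ c
          ... | yes e = All.++⁻ˡ base (proj₂ (fresh k e))
          ... | no n rewrite stale k n = cleared u (done-old d n)

          cleared' : ∀ u → Done (suc t) u → All (Clears (proj₁ (slot u)) (y' u)) base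
          cleared' u = cleared-kind (proj₂ (kind u))

          separate : ∀ {u w} → toℕ u < toℕ w → cen u ≢ cen w → does (adj? u w) ≡ true
          separate l n = no-edge l (n ∘ edge-cen)

          centre-leaf : ∀ {l} (lf : Leaf c l) → toℕ c < toℕ l → proj₁ (nb l (leaf∈ lf)) ⟶ v
          centre-leaf {l} lf lt with before lt | nb l (leaf∈ lf)
          ... | inj₁ b< | z , _ , _ , bk = trans (sym (back-< v z b<)) bk
          ... | inj₂ (_ , o , _) | _ = ⊥-elim (⊥-true o (center-even (leaf-center lf)))

          leaf-centre : ∀ {l} (lf : Leaf c l) → toℕ l < toℕ c → v ⟶ proj₁ (nb l (leaf∈ lf))
          leaf-centre {l} lf lt with before lt | nb l (leaf∈ lf)
          ... | inj₁ b< | z , _ , _ , bk = trans (sym (back-> v z b<)) bk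
          ... | inj₂ (e , o , _) | _ = ⊥-elim (⊥-true o (trans (cong odd e) (center-even (leaf-center lf))))

          -- Edges at the centre are back edges by construction, two leaves share a transitive
          -- block, a new and an old vertex are joined forward because the new one was chosen clear
          -- of `sel`, and two old ones are settled already.
          related-kind : ∀ {u w z z'} → Kind u z → Kind w z' → Done (suc t) u → Done (suc t) w → toℕ u < toℕ w → Oriented (does (adj? u w)) z z'
          related-kind (centre refl) (centre refl) d d' lt = ⊥-elim (<-irrefl refl lt)
          related-kind {u} {w} (centre refl) (leaf lf) d d' lt rewrite edge lt (leaf-edge lf) = centre-leaf lf lt
          related-kind {u} {w} (leaf lf) (centre refl) d d' lt rewrite edge lt (BEdge-sym (leaf-edge lf)) = leaf-centre lf lt
          related-kind {u} {w} (leaf lf) (leaf lf') d d' lt rewrite no-edge lt (leaf-leaf lf lf') =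
            ordered (proj₁ (fresh (leaf lf) (proj₁ lf))) (proj₁ (fresh (leaf lf') (proj₁ lf'))) (before lt)
              (λ b< → ⊥-elim (<-irrefl (leaves-block lf lf' lt) b<))
          related-kind {u} {w} (old n) (old n') d d' lt = related u w (done-old d n) (done-old d' n') lt
          related-kind {u} {w} (old n) k' d d' lt with cen w Fin.≟ c
          ... | no n' rewrite stale k' n' = related u w (done-old d n) (done-old d' n') lt
          ... | yes e rewrite separate lt (λ h → n (trans h e)) =
            ordered (placed u (done-old d n)) (proj₁ (fresh k' e)) (before lt) (proj₁ (All.lookup (proj₂ (fresh k' e)) (sel-old (done-old d n))))
          related-kind {u} {w} k (old n') d d' lt with cen u Fin.≟ c
          ... | no n rewrite stale k n = related u w (done-old d n) (done-old d' n') lt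
          ... | yes e rewrite separate lt (λ h → n' (trans (sym h) e)) =
            ordered (proj₁ (fresh k e)) (placed w (done-old d' n')) (before lt) (proj₂ (All.lookup (proj₂ (fresh k e)) (sel-old (done-old d' n'))))

          related' : ∀ u w → Done (suc t) u → Done (suc t) w → toℕ u < toℕ w → Oriented (does (adj? u w)) (y' u) (y' w)
          related' u w = related-kind (proj₂ (kind u)) (proj₂ (kind w))

        next : Partial (suc t)
        next with cen c Fin.≟ c
        ... | yes e = extend e starAt
        ... | no n = skip n

      partial : ∀ t → t ≤ r → Partial t
      -- No vertex is done at stage 0, so `default` is only a placeholder that makes `y` total.
      partial zero _ = record { y = λ _ → default ; placed = λ _ () ; cleared = λ _ () ; related = λ _ _ () }
      partial (suc t) l = Step.next l (partial t (≤-trans (n≤1+n t) l))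

      galaxy-copy : Partial r
      galaxy-copy = partial r ≤-refl

-- Minimal counterexamples

^-distribʳ-* : ∀ m n o → (m * n) ^ o ≡ m ^ o * n ^ o
^-distribʳ-* m n zero = refl
^-distribʳ-* m n (suc o) = trans (cong (m * n *_) (^-distribʳ-* m n o)) (swap m n (m ^ o) (n ^ o))
  where
  swap : ∀ a b c d → a * b * (c * d) ≡ a * c * (b * d)
  swap = solve-∀

^-reflects-< : ∀ {m n} o → m ^ o < n ^ o → m < n
^-reflects-< o l = ≰⇒> λ h → <⇒≱ l (^-monoˡ-≤ o h)

n≤n^1+o : ∀ n o → n ≤ n ^ suc o
n≤n^1+o zero o = z≤n
n≤n^1+o n@(suc _) o = ≤-trans (≤-reflexive (sym (*-identityʳ n))) (*-monoʳ-≤ n (m^n>0 n o))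

n≤2^n : ∀ n → n ≤ 2 ^ n
n≤2^n zero = z≤n
n≤2^n (suc n) = ≤-trans (+-mono-≤ (m^n>0 2 n) (n≤2^n n)) (≤-reflexive (cong (2 ^ n +_) (sym (+-identityʳ (2 ^ n)))))

-- Bernoulli's inequality (1 + 1/d)^m ≥ 1 + m/d with denominators cleared.
bernoulli : ∀ d m → d ^ m * (d + m) ≤ suc d ^ m * d
bernoulli d zero = ≤-reflexive (cong (1 *_) (+-identityʳ d))
bernoulli d (suc m) = begin
  d * d ^ m * (d + suc m)      ≡⟨ e₁ d (d ^ m) m ⟩
  d ^ m * (d * (d + suc m))    ≤⟨ *-monoʳ-≤ (d ^ m) (≤-trans (m≤m+n _ m) (≤-reflexive (e₂ d m))) ⟩
  d ^ m * (suc d * (d + m))    ≡⟨ e₃ (d ^ m) (suc d) (d + m) ⟩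
  suc d * (d ^ m * (d + m))    ≤⟨ *-monoʳ-≤ (suc d) (bernoulli d m) ⟩
  suc d * (suc d ^ m * d)      ≡⟨ sym (*-assoc (suc d) (suc d ^ m) d) ⟩
  suc d * suc d ^ m * d        ∎
  where
  open ≤-Reasoning
  e₁ : ∀ d p m → d * p * (d + suc m) ≡ p * (d * (d + suc m))
  e₁ = solve-∀
  e₂ : ∀ d m → d * (d + suc m) + m ≡ suc d * (d + m)
  e₂ = solve-∀
  e₃ : ∀ a b c → a * (b * c) ≡ b * (a * c)
  e₃ = solve-∀

-- The exponent (d + 1)² makes (1 + 1/d)^m at least d + 1.
power-gap : ∀ d → 1 ≤ d → d ^ (suc d * suc d) * suc d ≤ suc d ^ (suc d * suc d)
power-gap d@(suc _) _ = *-cancelʳ-≤ _ _ d (begin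
  d ^ m * suc d * d     ≡⟨ *-assoc (d ^ m) (suc d) d ⟩
  d ^ m * (suc d * d)   ≤⟨ *-monoʳ-≤ (d ^ m) (≤-trans (m≤m+n _ (suc d + d)) (≤-reflexive (e d))) ⟩
  d ^ m * (d + m)       ≤⟨ bernoulli d m ⟩
  suc d ^ m * d         ∎)
  where
  open ≤-Reasoning
  m = suc d * suc d
  e : ∀ d → suc d * d + (suc d + d) ≡ d + suc d * suc d
  e = solve-∀

root : ∀ {n} q j → 1 ≤ q → 1 ≤ n → n ≤ j ^ q → ∃ λ k → k ^ q < n × n ≤ suc k ^ q
root (suc q) zero _ n≥1 l = ⊥-elim (<⇒≱ n≥1 l)
root {n} q (suc j) q≥1 n≥1 l with n ≤? j ^ q
... | yes l' = root q j q≥1 n≥1 l'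
... | no l' = j , ≰⇒> l' , l

quotient : ∀ n c → 1 ≤ c → c ≤ n → ∃ λ s → 1 ≤ s × s * c ≤ n × n ≤ 2 * c * s
quotient n c@(suc _) _ c≤n = s , s≥1 , m/n*n≤m n c , below
  where
  s = n / c
  close : n ≤ c + s * c
  close = ≤-trans (≤-reflexive (m≡m%n+[m/n]*n n c)) (+-monoˡ-≤ (s * c) (<⇒≤ (m%n<n n c)))
  s≥1 : 1 ≤ s
  s≥1 with s in eq
  ... | suc _ = s≤s z≤n
  ... | zero = ⊥-elim (<⇒≱ (m%n<n n c) (≤-trans c≤n (≤-reflexive (trans (m≡m%n+[m/n]*n n c) (trans (cong (λ k → n % c + k * c) eq) (+-identityʳ _))))))
  double : ∀ c s → s * c + s * c ≡ 2 * c * s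
  double = solve-∀
  below : n ≤ 2 * c * s
  below = ≤-trans close (≤-trans (+-monoˡ-≤ (s * c) (≤-trans (≤-reflexive (sym (*-identityˡ c))) (*-monoˡ-≤ c s≥1))) (≤-reflexive (double c s)))

-- 1 / spread bounds from below the relative size of every set to which minimality is applied.
spread : (h M N E D : ℕ) → ℕ
spread h M N E D = 4 * (2 * blockFactor h N (2 * (M * N) * (2 * E)) M) * N * D

spread≥4 : ∀ {h} → 1 ≤ h → ∀ M E {N D} → 1 ≤ N → 1 ≤ D → 4 ≤ spread h M N E D
spread≥4 {h} h≥1 M E {N} {D} N≥1 D≥1 =
  *-mono-≤ {4} {4 * C₁ * N} {1} (*-mono-≤ {4} {4 * C₁} {1} (*-mono-≤ {4} {4} ≤-refl (*-mono-≤ {1} {2} (s≤s z≤n) (blockFactor-pos h≥1 N Λ M))) N≥1) D≥1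
  where
  Λ = 2 * (M * N) * (2 * E)
  C₁ = 2 * blockFactor h N Λ M

-- Abstract: for M = 12 + …, unfolding blockFactor would produce an expression of tower size.
abstract
  exponent : (h M N E D : ℕ) → ℕ
  exponent h M N E D = spread h M N E D * spread h M N E D

  exponent-def : ∀ h M N E D → exponent h M N E D ≡ spread h M N E D * spread h M N E D
  exponent-def h M N E D = refl

exponent≥1 : ∀ {h} → 1 ≤ h → ∀ M E {N D} → 1 ≤ N → 1 ≤ D → 1 ≤ exponent h M N E D
exponent≥1 {h} h≥1 M E {N} {D} N≥1 D≥1 = subst (1 ≤_) (sym (exponent-def h M N E D)) (*-mono-≤ spread≥1 spread≥1)
  where
  spread≥1 = ≤-trans (≤ᵇ⇒≤ 1 4 _) (spread≥4 h≥1 M E N≥1 D≥1)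

-- Chains and the descent

module Critical {V : Set} (b : V → V → Bool) (b-anti : ∀ x y → x ≢ y → b x y ≡ not (b y x)) (b-irr : ∀ x → b x x ≡ false) where
  open Tournament b b-anti
  open Structure b b-anti
  open Hosts b b-anti

  -- A transitive subtournament is kept as the list of its vertices in transitive order, so that
  -- joining two of them is concatenation.
  Chain : List V → List V → Set
  Chain X ys = ys ⊆ X × AllPairs _⟶_ ys

  chain-unique : ∀ {ys} → AllPairs _⟶_ ys → Unique ys
  chain-unique = AllPairs.map λ { e refl → ⊥-true e (b-irr _) }

  -- The descent has to decide whether some chain exceeds k. By truncation it suffices to search for
  -- chains of one exact length.
  chain? : ∀ m X → Dec (∃ λ ys → Chain X ys × length ys ≡ m)
  chain? zero X = yes ([] , ((λ ()) , []) , refl)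
  chain? (suc m) X = map′ to from (Any.any? (λ x → chain? m (filterᵇ (b x) X)) X)
    where
    to : Any (λ x → ∃ λ ys → Chain (filterᵇ (b x) X) ys × length ys ≡ m) X → ∃ λ ys → Chain X ys × length ys ≡ suc m
    to a = let x , x∈ , ys , (sub , ap) , len = find a
           in x ∷ ys , ((λ { (here refl) → x∈ ; (there k) → filterᵇ-⊆ (b x) X (sub k) }) ,
                        (All.tabulate (λ k → proj₂ (∈-filterᵇ⁻ (b x) X (sub k))) ∷ ap)) , cong suc len
    from : (∃ λ ys → Chain X ys × length ys ≡ suc m) → Any (λ x → ∃ λ ys → Chain (filterᵇ (b x) X) ys × length ys ≡ m) X
    from (x ∷ ys , (sub , (h ∷ ap)) , len) = lose (sub (here refl)) (ys , ((λ k → ∈-filterᵇ⁺ (b x) X (sub (there k)) (All.lookup h k)) , ap) , suc-injective len)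

  -- The out-neighbours or the in-neighbours of the first vertex number at least half of what is
  -- needed; that vertex is put before or after the chain found there.
  log-chain : ∀ m X → Unique X → 2 ^ m ≤ length X → ∃ λ ys → Chain X ys × suc m ≤ length ys
  log-chain zero (x ∷ X) _ _ = x ∷ [] , ((λ { (here e) → here e }) , ([] ∷ [])) , s≤s z≤n
  log-chain (suc m) [] _ l = ⊥-elim (<⇒≱ (m^n>0 2 (suc m)) l)
  log-chain (suc m) (x ∷ X) (x∉ ∷ X!) l with 2 ^ m ≤? # (b x) X
  ... | yes big = let ys , (sub , ap) , len = log-chain m (filterᵇ (b x) X) (AllPairs-filterᵇ (b x) X!) big
      in x ∷ ys , ((λ { (here e) → here e ; (there k) → there (filterᵇ-⊆ (b x) X (sub k)) }) ,
                   (All.tabulate (λ k → proj₂ (∈-filterᵇ⁻ (b x) X (sub k))) ∷ ap)) , s≤s len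
  ... | no small = let ys , (sub , ap) , len = log-chain m (filterᵇ (not ∘ b x) X) (AllPairs-filterᵇ (not ∘ b x) X!) big
      in ys ++ x ∷ [] , ((λ k → [ (λ k → there (filterᵇ-⊆ (not ∘ b x) X (sub k))) , (λ { (here e) → here e }) ]′ (∈-++⁻ ys k)) ,
                        AllPairs.++⁺ ap ([] ∷ []) (All.tabulate λ k → let y∈ , e = ∈-filterᵇ⁻ (not ∘ b x) X (sub k) in flip (All.lookup x∉ y∈) (not-true e) ∷ [])) ,
         ≤-trans (s≤s len) (≤-reflexive (sym (trans (length-++ ys) (+-comm (length ys) 1))))
    where
    big : 2 ^ m ≤ # (not ∘ b x) X
    big = +-cancelˡ-≤ (2 ^ m) _ _ (s≤s⁻¹ (begin-strict
      2 ^ m + 2 ^ m                      ≡⟨ cong (2 ^ m +_) (sym (+-identityʳ (2 ^ m))) ⟩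
      2 ^ suc m                          ≤⟨ l ⟩
      suc (length X)                     ≡⟨ cong suc (sym (#-compl (b x) X)) ⟩
      suc (# (b x) X) + # (not ∘ b x) X  ≤⟨ +-monoˡ-≤ _ (≰⇒> small) ⟩
      2 ^ m + # (not ∘ b x) X            <⟨ ≤-refl ⟩
      suc (2 ^ m + # (not ∘ b x) X)      ∎))
      where open ≤-Reasoning

  Goal : ℕ → List V → Set
  Goal q X = ∃ λ ys → Chain X ys × length X ≤ length ys ^ q

  module _ (h : ℕ) (H : Fin h → Fin h → Bool) (H-anti : ∀ i j → i ≢ j → H i j ≡ not (H j i)) (h≥1 : 1 ≤ h) (free : ¬ Copy h H)
           (tr : ℕ → Bool) (M N E D : ℕ) (N≥1 : 1 ≤ N) (D≥1 : 1 ≤ D) (no-host : ∀ X → ¬ Host X tr M N E D) where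

    private
      Λ c C₁ C q : ℕ
      Λ = 2 * (M * N) * (2 * E)
      c = blockFactor h N Λ M
      C₁ = 2 * c
      C = spread h M N E D
      q = C * C

    private
      c≥1 : 1 ≤ c
      c≥1 = blockFactor-pos h≥1 N Λ M

      C₁≥1 : 1 ≤ C₁
      C₁≥1 = *-mono-≤ {1} {2} (s≤s z≤n) c≥1

      scaled : ∀ k → k ≤ k * D
      scaled k = ≤-trans (≤-reflexive (sym (*-identityʳ k))) (*-monoʳ-≤ k D≥1)

      C₁N≤C : C₁ * N ≤ C
      C₁N≤C = ≤-trans (≤-trans (m≤m+n _ (3 * (C₁ * N))) (≤-reflexive (e C₁ N))) (scaled (4 * C₁ * N))
        where
        e : ∀ a n → a * n + 3 * (a * n) ≡ 4 * a * n
        e = solve-∀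

      C₁D≤C : 2 * D * C₁ ≤ C
      C₁D≤C = ≤-trans (≤-trans (≤-reflexive (sym (*-identityʳ (2 * D * C₁)))) (*-monoʳ-≤ (2 * D * C₁) N≥1)) (≤-trans (m≤m+n _ (2 * D * C₁ * N)) (≤-reflexive (e D C₁ N)))
        where
        e : ∀ d a n → 2 * d * a * n + 2 * d * a * n ≡ 4 * a * n * d
        e = solve-∀

      C₁≤C : C₁ ≤ C
      C₁≤C = ≤-trans (≤-trans (≤-reflexive (sym (*-identityʳ C₁))) (*-monoʳ-≤ C₁ N≥1)) C₁N≤C

      4≤C : 4 ≤ C
      4≤C = spread≥4 h≥1 M E N≥1 D≥1

      C≤q : C ≤ q
      C≤q = ≤-trans (≤-reflexive (sym (*-identityʳ C))) (*-monoʳ-≤ C (≤-trans (≤ᵇ⇒≤ 1 4 _) 4≤C))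

      c≤C : c ≤ C
      c≤C = ≤-trans (m≤m+n c _) C₁≤C

    private
      q≥1 : 1 ≤ q
      q≥1 = ≤-trans (≤-trans (≤ᵇ⇒≤ 1 4 _) 4≤C) C≤q

      C≤2^q : C ≤ 2 ^ q
      C≤2^q = ≤-trans (n≤2^n C) (^-monoʳ-≤ 2 C≤q)

      shrink : ∀ p → 1 ≤ p → ∀ k → k ≤ k ^ p
      shrink (suc p) _ k = n≤n^1+o k p

      gap : ∀ K → 2 ≤ K → pred K ^ (K * K) * K ≤ K ^ (K * K)
      gap (suc d) (s≤s d≥1) = power-gap d d≥1

    -- X plays a minimal counterexample and k is the integer with k ^ q < |X| ≤ (k + 1) ^ q, so no chain exceeds k.
    module Minimal (X : List V) (X! : Unique X) (IH : ∀ Y → Unique Y → length Y < length X → Goal q Y)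
                   (k : ℕ) (k^q<n : k ^ q < length X) (C≤k : C ≤ k) (max : ∀ ys → Chain X ys → length ys ≤ k) where

      private
        n = length X
        C≤n : C ≤ n
        C≤n = ≤-trans C≤k (≤-trans (shrink q q≥1 k) (<⇒≤ k^q<n))

      -- The induction hypothesis needs a set smaller than X, while `A` may be all of it. Dropping
      -- to n - 1 vertices is harmless because K ≥ 2 gives n ≤ K * (n - 1).
      large-chain : ∀ K A → 2 ≤ K → Unique A → n ≤ K * length A → ∃ λ xs → Chain A xs × n ≤ K * length xs ^ q
      large-chain K A 2≤K A! l =
        let xs , (sub , ap) , len = IH (take (pred n) A) (Unique.take⁺ (pred n) A!) smaller
        in xs , ((λ m → take-⊆ (pred n) A (sub m)) , ap) , ≤-trans still (*-monoʳ-≤ K len)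
        where
        2≤n : 2 ≤ n
        2≤n = ≤-trans (≤ᵇ⇒≤ 2 4 _) (≤-trans 4≤C C≤n)
        smaller : length (take (pred n) A) < n
        smaller = ≤-<-trans (≤-trans (≤-reflexive (length-take (pred n) A)) (m⊓n≤m (pred n) (length A))) (pred< 2≤n)
          where
          pred< : ∀ {m} → 2 ≤ m → pred m < m
          pred< {suc m} _ = ≤-refl
        twice : ∀ {m} → 2 ≤ m → m ≤ 2 * pred m
        twice {suc (suc m)} _ = s≤s (≤-trans (s≤s (m≤m+n m _)) (≤-reflexive (sym (+-suc m _))))
        twice {suc zero} (s≤s ())
        still : n ≤ K * length (take (pred n) A)
        still rewrite length-take (pred n) A with ⊓-sel (pred n) (length A)
        ... | inj₁ e rewrite e = ≤-trans (twice 2≤n) (*-monoˡ-≤ (pred n) 2≤K)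
        ... | inj₂ e rewrite e = l

      -- The chains found in the two sets concatenate to one of length at most k, so one of them has
      -- length a with 2a ≤ k. Then n ≤ C * a^q ≤ (2a)^q ≤ k^q < n, as C ≤ 2^q.
      large-large : ∀ A B → Unique A → Unique B → A ⊆ X → B ⊆ X → n ≤ C * length A → n ≤ C * length B → ¬ Complete A B
      large-large A B A! B! A⊆ B⊆ lA lB complete =
        let xs , (xs⊆ , xs-ap) , lx = large-chain C A 2≤C A! lA
            ys , (ys⊆ , ys-ap) , ly = large-chain C B 2≤C B! lB
            both = max (xs ++ ys) ((λ m → [ (λ m → A⊆ (xs⊆ m)) , (λ m → B⊆ (ys⊆ m)) ]′ (∈-++⁻ xs m)) ,
                     AllPairs.++⁺ xs-ap ys-ap (All.tabulate λ m → All.tabulate λ l → complete (xs⊆ m) (ys⊆ l)))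
        in halves (length xs) (length ys) lx ly (≤-trans (≤-reflexive (sym (length-++ xs))) both)
        where
        2≤C : 2 ≤ C
        2≤C = ≤-trans (≤ᵇ⇒≤ 2 4 _) 4≤C
        absurd : ∀ a → n ≤ C * a ^ q → 2 * a ≤ k → ⊥
        absurd a l l' = <-irrefl refl (begin-strict
          (2 * a) ^ q     ≤⟨ ^-monoˡ-≤ q l' ⟩
          k ^ q           <⟨ k^q<n ⟩
          n               ≤⟨ l ⟩
          C * a ^ q       ≤⟨ *-monoˡ-≤ (a ^ q) C≤2^q ⟩
          2 ^ q * a ^ q   ≡⟨ sym (^-distribʳ-* 2 a q) ⟩
          (2 * a) ^ q     ∎)
          where open ≤-Reasoning
        halves : ∀ a a' → n ≤ C * a ^ q → n ≤ C * a' ^ q → a + a' ≤ k → ⊥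
        halves a a' l l' s with ≤-total a a'
        ... | inj₁ le = absurd a l (≤-trans (+-monoʳ-≤ a (≤-trans (≤-reflexive (+-identityʳ a)) le)) s)
        ... | inj₂ ge = absurd a' l' (≤-trans (+-mono-≤ ge (≤-reflexive (+-identityʳ a'))) s)

      -- A chain of length a in `A` extends `S`, so a ≤ (1 - 1/C) k. Since q = C * C makes (1 -
      -- 1/C)^q at most 1/C, this gives C * a^q < n, against the choice of the chain.
      large-transitive : ∀ A S → Unique A → AllPairs _⟶_ S → A ⊆ X → S ⊆ X → n ≤ C * length A → k ≤ C * length S →
        ¬ (Complete A S ⊎ Complete S A)
      large-transitive A S A! S-ap A⊆ S⊆ lA lS complete =
        let xs , (xs⊆ , xs-ap) , lx = large-chain C A 2≤C A! lA
        in absurd (length xs) lx (joined xs xs⊆ xs-ap complete)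
        where
        2≤C : 2 ≤ C
        2≤C = ≤-trans (≤ᵇ⇒≤ 2 4 _) 4≤C
        joined : ∀ xs → xs ⊆ A → AllPairs _⟶_ xs → Complete A S ⊎ Complete S A → length xs + length S ≤ k
        joined xs xs⊆ xs-ap (inj₁ co) = ≤-trans (≤-reflexive (sym (length-++ xs)))
          (max (xs ++ S) ((λ m → [ (λ m → A⊆ (xs⊆ m)) , S⊆ ]′ (∈-++⁻ xs m)) , AllPairs.++⁺ xs-ap S-ap (All.tabulate λ m → All.tabulate λ l → co (xs⊆ m) l)))
        joined xs xs⊆ xs-ap (inj₂ co) = ≤-trans (≤-reflexive (trans (+-comm (length xs) (length S)) (sym (length-++ S))))
          (max (S ++ xs) ((λ m → [ S⊆ , (λ m → A⊆ (xs⊆ m)) ]′ (∈-++⁻ S m)) , AllPairs.++⁺ S-ap xs-ap (All.tabulate λ m → All.tabulate λ l → co m (xs⊆ l))))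
        absurd : ∀ a → n ≤ C * a ^ q → a + length S ≤ k → ⊥
        absurd a l l' = <-irrefl refl (begin-strict
          (C * a) ^ q                ≤⟨ ^-monoˡ-≤ q small ⟩
          (pred C * k) ^ q           ≡⟨ ^-distribʳ-* (pred C) k q ⟩
          pred C ^ q * k ^ q         <⟨ *-monoʳ-< (pred C ^ q) {{>-nonZero positive}} k^q<n ⟩
          pred C ^ q * n             ≤⟨ *-monoʳ-≤ (pred C ^ q) l ⟩
          pred C ^ q * (C * a ^ q)   ≡⟨ sym (*-assoc (pred C ^ q) C (a ^ q)) ⟩
          pred C ^ q * C * a ^ q     ≤⟨ *-monoˡ-≤ (a ^ q) (gap C 2≤C) ⟩
          C ^ q * a ^ q              ≡⟨ sym (^-distribʳ-* C a q) ⟩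
          (C * a) ^ q                ∎)
          where
          open ≤-Reasoning
          positive : 0 < pred C ^ q
          positive = m^n>0 (pred C) {{>-nonZero (pred-mono-≤ 2≤C)}} q
          k+[C-1]k : ∀ K → 1 ≤ K → K * k ≡ pred K * k + k
          k+[C-1]k (suc K) _ = +-comm k (K * k)
          small : C * a ≤ pred C * k
          small = +-cancelʳ-≤ k _ _ (begin
            C * a + k                ≤⟨ +-monoʳ-≤ (C * a) lS ⟩
            C * a + C * length S     ≡⟨ sym (*-distribˡ-+ C a (length S)) ⟩
            C * (a + length S)       ≤⟨ *-monoʳ-≤ C l' ⟩
            C * k                    ≡⟨ k+[C-1]k C (≤-trans (n≤1+n 1) 2≤C) ⟩
            pred C * k + k           ∎)

      -- The sizes are n divided by `c` for large sets and k divided by `C₁ * N` for transitive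
      -- pieces, rounded down. The bound C ≤ k keeps both positive and the rounding loss within a
      -- factor 2.
      contradiction : ⊥
      contradiction with quotient n c c≥1 (≤-trans c≤C C≤n) | quotient k (C₁ * N) (*-mono-≤ C₁≥1 N≥1) (≤-trans C₁N≤C C≤k)
      ... | s , s≥1 , sc≤n , n≤C₁s | t , t≥1 , tC≤k , k≤t =
        no-host X (host s≥1 t≥1
          (λ A B A! B! A⊆ B⊆ lA lB → large-large A B A! B! A⊆ B⊆ (from-s A lA) (from-s B lB))
          (λ A S A! S-ap A⊆ S⊆ lA lS → large-transitive A S A! S-ap A⊆ S⊆ (from-s A lA) (from-t S lS))
          (blocks h H H-anti h≥1 N Λ free s t s≥1 t≥1 X transitive M tr X X! (λ m → m) sc≤n))
        where
        from-s : ∀ A → s ≤ 2 * D * length A → n ≤ C * length A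
        from-s A l = begin
          n                            ≤⟨ n≤C₁s ⟩
          C₁ * s                       ≤⟨ *-monoʳ-≤ C₁ l ⟩
          C₁ * (2 * D * length A)      ≡⟨ e C₁ D (length A) ⟩
          2 * D * C₁ * length A        ≤⟨ *-monoˡ-≤ (length A) C₁D≤C ⟩
          C * length A                 ∎
          where
          open ≤-Reasoning
          e : ∀ a d x → a * (2 * d * x) ≡ 2 * d * a * x
          e = solve-∀
        -- The losses here multiply to exactly C = 4 * C₁ * N * D: a factor 2 * C₁ * N from k to
        -- `t`, and 2 * D from `t` to `S`.
        from-t : ∀ S → t ≤ 2 * D * length S → k ≤ C * length S
        from-t S l = begin
          k                                  ≤⟨ k≤t ⟩
          2 * (C₁ * N) * t                   ≤⟨ *-monoʳ-≤ (2 * (C₁ * N)) l ⟩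
          2 * (C₁ * N) * (2 * D * length S)  ≡⟨ e C₁ N D (length S) ⟩
          C * length S                       ∎
          where
          open ≤-Reasoning
          e : ∀ a n d x → 2 * (a * n) * (2 * d * x) ≡ 4 * a * n * d * x
          e = solve-∀
        transitive : ∀ Z → Unique Z → Z ⊆ X → s ≤ length Z → ∃ λ ts → ts ⊆ Z × AllPairs _⟶_ ts × Unique ts × N * t ≤ length ts
        transitive Z Z! Z⊆ l =
          let ts , (sub , ap) , lt = large-chain C₁ Z (*-mono-≤ {2} {2} {1} ≤-refl c≥1) Z! (≤-trans n≤C₁s (*-monoʳ-≤ C₁ l))
          in ts , sub , ap , chain-unique ap , long (length ts) lt
          where
          open ≤-Reasoning
          e : ∀ a n t → a * (n * t) ≡ t * (a * n)
          e = solve-∀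
          -- The loss C₁ is absorbed into the base: n ≤ C₁ * a^q ≤ (C₁ * a)^q forces k < C₁ * a,
          -- hence N * t ≤ a.
          long : ∀ a → n ≤ C₁ * a ^ q → N * t ≤ a
          long a l = <⇒≤ (*-cancelˡ-< C₁ _ _ (≤-<-trans (≤-trans (≤-reflexive (e C₁ N t)) tC≤k) (^-reflects-< q (begin-strict
            k ^ q           <⟨ k^q<n ⟩
            n               ≤⟨ l ⟩
            C₁ * a ^ q      ≤⟨ *-monoˡ-≤ (a ^ q) (shrink q q≥1 C₁) ⟩
            C₁ ^ q * a ^ q  ≡⟨ sym (^-distribʳ-* C₁ a q) ⟩
            (C₁ * a) ^ q    ∎))))

    truncated : ∀ {X ys} m → Chain X ys → m ≤ length ys → ∃ λ zs → Chain X zs × length zs ≡ m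
    truncated {X} {ys} m (sub , ap) l = take m ys , ((λ k → sub (take-⊆ m ys k)) , AllPairs.take⁺ m ap) , trans (length-take m ys) (m≤n⇒m⊓n≡m l)

    private
      enough : ∀ {X k} → length X ≤ suc k ^ q → (∃ λ ys → Chain X ys × suc k ≤ length ys) → Goal q X
      enough l (ys , ch , len) = ys , ch , ≤-trans l (^-monoˡ-≤ q len)

      -- For k ≥ 2 the chain 2^k ≤ 2^q ≤ k^q < n applies; for k = 0 and k = 1 the power k^q does not
      -- dominate 2^q.
      2^k≤n : ∀ k n → 1 ≤ n → k ≤ q → k ^ q < n → 2 ^ k ≤ n
      2^k≤n zero n n≥1 _ _ = n≥1
      2^k≤n (suc zero) n _ _ l = ≤-trans (s≤s (m^n>0 1 q)) l
      2^k≤n k@(suc (suc _)) n _ k≤q l = ≤-trans (^-monoʳ-≤ 2 k≤q) (≤-trans (^-monoˡ-≤ q (s≤s (s≤s z≤n))) (<⇒≤ l))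

    -- If k < C, the logarithmic bound already gives a chain of k + 1 vertices. If k ≥ C, such a
    -- chain either exists or its absence makes X critical, which is impossible.
    erdős-hajnal : ∀ X → Unique X → Goal (exponent h M N E D) X
    erdős-hajnal X X! = subst (λ p → Goal p X) (sym (exponent-def h M N E D)) (<-rec (λ n → ∀ X → Unique X → length X ≡ n → Goal q X) descend (length X) X X! refl)
      where
      descend : ∀ n → (∀ {m} → m < n → ∀ Y → Unique Y → length Y ≡ m → Goal q Y) → ∀ X → Unique X → length X ≡ n → Goal q X
      descend _ rec [] _ refl = [] , ((λ ()) , []) , z≤n
      descend _ rec X@(_ ∷ _) X! refl with root q (length X) q≥1 (s≤s z≤n) (shrink q q≥1 (length X))
      ... | k , k^q<n , n≤ with C ≤? k
      ... | no C≰k = enough n≤ (log-chain k X X! (2^k≤n k (length X) (s≤s z≤n) (≤-trans (<⇒≤ (≰⇒> C≰k)) C≤q) k^q<n))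
      ... | yes C≤k with chain? (suc k) X
      ... | yes (ys , ch , len) = enough n≤ (ys , ch , ≤-reflexive (sym len))
      ... | no none = ⊥-elim (Minimal.contradiction X X! (λ Y Y! l → rec l Y Y! refl) k k^q<n C≤k
                        (λ ys ch → ≮⇒≥ λ l → none (truncated (suc k) ch l)))

-- Pseudogalaxies

module AsBool {V : Set} (_≟V_ : ∀ (x y : V) → Dec (x ≡ y)) {adj : V → V → Set} (tT : IsTournament adj) where

  adj? : ∀ x y → Dec (adj x y)
  adj? = decidable _≟V_ tT

  b : V → V → Bool
  b x y = does (adj? x y)

  b-irr : ∀ x → b x x ≡ false
  b-irr x = dec-false (adj? x x) (proj₁ tT x)

  b-anti : ∀ x y → x ≢ y → b x y ≡ not (b y x)
  b-anti x y n with proj₁ (proj₂ tT) x y n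
  ... | inj₁ e = trans (dec-true (adj? x y) e) (cong not (sym (dec-false (adj? y x) (proj₂ (proj₂ tT) x y e))))
  ... | inj₂ e = trans (dec-false (adj? x y) (proj₂ (proj₂ tT) y x e)) (cong not (sym (dec-true (adj? y x) e)))

  b-true : ∀ {x y} → b x y ≡ true → adj x y
  b-true {x} {y} e with adj? x y
  ... | yes p = p

-- Products and their copies

module Product {V₁ V₂ : Set} {a₁ : V₁ → V₁ → Set} {a₂ : V₂ → V₂ → Set} (a₁? : ∀ x y → Dec (a₁ x y)) (a₂? : ∀ x y → Dec (a₂ x y))
  (f₁ : V₁ → ℕ) (f₂ : V₂ → ℕ) (pos-injective : ∀ x y → pos f₁ f₂ x ≡ pos f₁ f₂ y → x ≡ y) where

  position : V₁ ⊎ V₂ → ℕ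
  position = pos f₁ f₂

  PB : V₁ ⊎ V₂ → V₁ ⊎ V₂ → Set
  PB = ProdBackward a₁ f₁ a₂ f₂

  PB? : ∀ x y → Dec (PB x y)
  PB? (inj₁ x) (inj₁ y) = a₁? x y ×-dec (f₁ y <? f₁ x)
  PB? (inj₂ x) (inj₂ y) = a₂? x y ×-dec (f₂ y <? f₂ x)
  PB? (inj₁ x) (inj₂ y) = no λ ()
  PB? (inj₂ x) (inj₁ y) = no λ ()

  prod : V₁ ⊎ V₂ → V₁ ⊎ V₂ → Bool
  prod x y = if position x <ᵇ position y then not (does (PB? y x)) else does (PB? x y)

  prod-< : ∀ {x y} → position x < position y → prod x y ≡ not (does (PB? y x))
  prod-< l rewrite <ᵇ-true l = refl

  prod-> : ∀ {x y} → position y < position x → prod x y ≡ does (PB? x y)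
  prod-> {x} {y} l rewrite <ᵇ-false {position x} {position y} (<⇒≤ l) = refl

  prod-anti : ∀ x y → x ≢ y → prod x y ≡ not (prod y x)
  prod-anti x y n with <-cmp (position x) (position y)
  ... | tri< l _ _ = trans (prod-< {x} {y} l) (cong not (sym (prod-> {y} {x} l)))
  ... | tri≈ _ e _ = ⊥-elim (n (pos-injective x y e))
  ... | tri> _ _ l = trans (prod-> {x} {y} l) (trans (not-not (does (PB? x y))) (cong not (sym (prod-< {y} {x} l))))
    where
    not-not : ∀ t → t ≡ not (not t)
    not-not true = refl
    not-not false = refl

  module _ {V : Set} {adj : V → V → Set} (tT : IsTournament adj) where

    Respects : (V₁ ⊎ V₂ → V) → Set
    Respects f = ∀ x y → position x < position y → (PB y x × adj (f y) (f x)) ⊎ (¬ PB y x × adj (f x) (f y))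

    contains : (f : V₁ ⊎ V₂ → V) → Respects f → Contains adj (Prod a₁ f₁ a₂ f₂)
    contains f res = f , injective , λ x y → mk⇔ (to x y) (from x y)
      where
      irr = proj₁ tT
      asym = proj₂ (proj₂ tT)
      injective : Injective _≡_ _≡_ f
      injective {x} {y} e with <-cmp (position x) (position y)
      ... | tri≈ _ p _ = pos-injective x y p
      ... | tri< l _ _ = ⊥-elim ([ (λ (_ , a) → irr _ (subst (adj (f y)) e a)) , (λ (_ , a) → irr _ (subst (λ v → adj v (f y)) e a)) ]′ (res x y l))
      ... | tri> _ _ l = ⊥-elim ([ (λ (_ , a) → irr _ (subst (λ v → adj v (f y)) e a)) , (λ (_ , a) → irr _ (subst (adj (f y)) e a)) ]′ (res y x l))
      to : ∀ x y → adj (f x) (f y) → Prod a₁ f₁ a₂ f₂ x y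
      to x y a with <-cmp (position x) (position y)
      ... | tri≈ _ p _ = ⊥-elim (irr _ (subst (λ z → adj (f x) (f z)) (sym (pos-injective x y p)) a))
      ... | tri< l _ _ = [ (λ (_ , a') → ⊥-elim (asym _ _ a a')) , (λ (n , _) → inj₁ (l , n)) ]′ (res x y l)
      ... | tri> _ _ l = [ (λ (p , _) → inj₂ (l , p)) , (λ (_ , a') → ⊥-elim (asym _ _ a a')) ]′ (res y x l)
      from : ∀ x y → Prod a₁ f₁ a₂ f₂ x y → adj (f x) (f y)
      from x y (inj₁ (l , n)) = [ (λ (p , _) → ⊥-elim (n p)) , proj₂ ]′ (res x y l)
      from x y (inj₂ (l , p)) = [ proj₂ , (λ (n , _) → ⊥-elim (n p)) ]′ (res y x l)

-- Parameters and assembly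

module Pseudogalaxy {r : ℕ} {adjG : Fin r → Fin r → Set} (tG : IsTournament adjG) (g : GalaxyOrdering adjG) (s : ℕ)
  (split : SplitOK g s) where
  open Galaxy tG g s split
  open GalaxyOrdering g using (cen)

  Hl? : ∀ x y → Dec (Hl x y)
  Hl? x y = ((x Fin.<? y) ×-dec (¬? (HlBack? y x))) ⊎-dec ((y Fin.<? x) ×-dec (HlBack? x y))

  ρ₁-early : ∀ i → i ≢ 6F → ρ₁ s i ≡ suc (toℕ i)
  ρ₁-early i n = cong (λ t → if t then 7 + s else suc (toℕ i)) (dec-false (toℕ i ≟ 6) (n ∘ Fin.toℕ-injective))

  early-<6 : ∀ {i : Fin 7} → i ≢ 6F → toℕ i < 6
  early-<6 {i} n = ≤∧≢⇒< (s≤s⁻¹ (Fin.toℕ<n i)) (n ∘ Fin.toℕ-injective)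

  ρ₁-mono : ∀ {i j} → toℕ i < toℕ j → ρ₁ s i < ρ₁ s j
  ρ₁-mono {i} {j} l with j Fin.≟ 6F
  ... | yes refl rewrite ρ₁-early i (λ { refl → <-irrefl refl l }) = ≤-trans (s≤s l) (m≤m+n 7 s)
  ... | no n rewrite ρ₁-early i (λ { refl → n (Fin.toℕ-injective (≤-antisym (s≤s⁻¹ (Fin.toℕ<n j)) (<⇒≤ l))) }) | ρ₁-early j n = s≤s l

  ρ₁-reflects : ∀ {i j} → ρ₁ s i < ρ₁ s j → toℕ i < toℕ j
  ρ₁-reflects {i} {j} l with <-cmp (toℕ i) (toℕ j)
  ... | tri< lt _ _ = lt
  ... | tri≈ _ e _ rewrite Fin.toℕ-injective e = ⊥-elim (<-irrefl refl l)
  ... | tri> _ _ gt = ⊥-elim (<-asym l (ρ₁-mono gt))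

  ρ₂-π : ∀ u → ρ₂ s u ≡ 7 + π u
  ρ₂-π u with does (suc (toℕ u) ≤? s)
  ... | true = refl
  ... | false = refl

  ρ₁<ρ₂ : ∀ {i} → i ≢ 6F → ∀ u → ρ₁ s i < ρ₂ s u
  ρ₁<ρ₂ {i} n u rewrite ρ₁-early i n | ρ₂-π u = ≤-trans (s≤s (early-<6 n)) (m≤m+n 7 (π u))

  π≢s : ∀ u → π u ≢ s
  π≢s u e with π-cases u
  ... | inj₁ (l , e') = <-irrefl (trans (sym e') e) l
  ... | inj₂ (l , e') = <-irrefl (sym (trans (sym e') e)) (s≤s l)

  pos-injective : ∀ x y → pos (ρ₁ s) (ρ₂ s) x ≡ pos (ρ₁ s) (ρ₂ s) y → x ≡ y
  pos-injective (inj₁ i) (inj₁ j) e with <-cmp (toℕ i) (toℕ j)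
  ... | tri< l _ _ = ⊥-elim (<-irrefl e (ρ₁-mono l))
  ... | tri≈ _ p _ = cong inj₁ (Fin.toℕ-injective p)
  ... | tri> _ _ l = ⊥-elim (<-irrefl (sym e) (ρ₁-mono l))
  pos-injective (inj₂ u) (inj₂ w) e with <-cmp (toℕ u) (toℕ w)
  ... | tri< l _ _ = ⊥-elim (<-irrefl (+-cancelˡ-≡ 7 _ _ (trans (sym (ρ₂-π u)) (trans e (ρ₂-π w)))) (π-mono l))
  ... | tri≈ _ p _ = cong inj₂ (Fin.toℕ-injective p)
  ... | tri> _ _ l = ⊥-elim (<-irrefl (+-cancelˡ-≡ 7 _ _ (trans (sym (ρ₂-π w)) (trans (sym e) (ρ₂-π u)))) (π-mono l))
  pos-injective (inj₁ i) (inj₂ u) e with i Fin.≟ 6F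
  ... | yes refl = ⊥-elim (π≢s u (+-cancelˡ-≡ 7 _ _ (trans (sym (ρ₂-π u)) (sym e))))
  ... | no n = ⊥-elim (<-irrefl e (ρ₁<ρ₂ n u))
  pos-injective (inj₂ u) (inj₁ i) e with i Fin.≟ 6F
  ... | yes refl = ⊥-elim (π≢s u (+-cancelˡ-≡ 7 _ _ (trans (sym (ρ₂-π u)) e)))
  ... | no n = ⊥-elim (<-irrefl (sym e) (ρ₁<ρ₂ n u))

  open Product Hl? adj? (ρ₁ s) (ρ₂ s) pos-injective

  h : ℕ
  h = 7 + r

  H : Fin h → Fin h → Bool
  H i j = prod (splitAt 7 i) (splitAt 7 j)

  splitAt-injective : ∀ (i j : Fin h) → splitAt 7 i ≡ splitAt 7 j → i ≡ j
  splitAt-injective i j e = trans (sym (Fin.join-splitAt 7 r i)) (trans (cong (join 7 r) e) (Fin.join-splitAt 7 r j))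

  H-anti : ∀ i j → i ≢ j → H i j ≡ not (H j i)
  H-anti i j n = prod-anti (splitAt 7 i) (splitAt 7 j) (n ∘ splitAt-injective i j)

  -- There are two ranges of blocks for G, starting at off₁ and off₂: when the h₇ found for the first range closes a
  -- triangle with h₃ and h₅, it becomes the h₆ of a copy whose G lies in the second range.
  off₁ off₂ M N L D E : ℕ
  off₁ = 12
  off₂ = off₁ + 2 * suc (suc r)
  M = off₂ + 2 * suc (suc r)
  -- N provides three pieces in block 3 and piece indices up to r for G; L counts all vertices of H;
  -- D allows for a cherry (8) and for a star with at most r leaves (2 * 2 ^ r); E is the smoothness
  -- required by `clear-half`.
  N = 3 + r
  L = 7 + r
  D = 8 * 2 ^ r
  E = 2 * L

  module InTournament {V : Set} (_≟V_ : ∀ (x y : V) → Dec (x ≡ y)) {adj : V → V → Set} (tT : IsTournament adj) where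
    open AsBool _≟V_ tT hiding (adj?)
    open Tournament b b-anti using (Copy)
    open Structure b b-anti using (_⟶_)
    open Hosts b b-anti using (Host)
    open Stars b b-anti b-irr
    open Critical b b-anti b-irr

    copy-contains : Copy h H → Contains adj (RightPseudogalaxy adjG s)
    copy-contains (f , ok) = contains tT (f ∘ join 7 r) respects
      where
      respects : Respects tT (f ∘ join 7 r)
      respects x y l = result (PB? y x) (trans (ok _ _ i≢j) value)
        where
        i≢j : join 7 r x ≢ join 7 r y
        i≢j e = <-irrefl (cong position (trans (sym (Fin.splitAt-join 7 r x)) (trans (cong (splitAt 7) e) (Fin.splitAt-join 7 r y)))) l
        value : H (join 7 r x) (join 7 r y) ≡ not (does (PB? y x))
        value = trans (cong₂ prod (Fin.splitAt-join 7 r x) (Fin.splitAt-join 7 r y)) (prod-< {x} {y} l)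
        -- `Copy` does not ask for injectivity. It follows because exactly one of the two directions
        -- holds in H, while a loop would make both false.
        distinct-images : f (join 7 r x) ≢ f (join 7 r y)
        distinct-images e = go (prod x y) (prod y x) (trans (ok _ _ i≢j) (cong₂ prod (Fin.splitAt-join 7 r x) (Fin.splitAt-join 7 r y)))
          (trans (ok _ _ (i≢j ∘ sym)) (cong₂ prod (Fin.splitAt-join 7 r y) (Fin.splitAt-join 7 r x))) (prod-anti x y (λ { refl → <-irrefl refl l }))
          where
          loop : b (f (join 7 r x)) (f (join 7 r y)) ≡ false
          loop = trans (cong (b _) (sym e)) (b-irr _)
          loop' : b (f (join 7 r y)) (f (join 7 r x)) ≡ false
          loop' = trans (cong (b _) e) (b-irr _)
          go : ∀ t t' → b (f (join 7 r x)) (f (join 7 r y)) ≡ t → b (f (join 7 r y)) (f (join 7 r x)) ≡ t' → t ≡ not t' → ⊥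
          go true _ p _ _ = ⊥-true p loop
          go false true _ p _ = ⊥-true p loop'
        result : (d : Dec (PB y x)) → b (f (join 7 r x)) (f (join 7 r y)) ≡ not (does d) →
          (PB y x × adj (f (join 7 r y)) (f (join 7 r x))) ⊎ (¬ PB y x × adj (f (join 7 r x)) (f (join 7 r y)))
        result (yes p) e = inj₁ (p , b-true (trans (b-anti _ _ (distinct-images ∘ sym)) (cong not e)))
        result (no n) e = inj₂ (n , b-true e)

    module _ (s≤r : s ≤ r) {X : List V} (host : Host X odd M N E D) where
      open InHost {L = L} host

      -- The number `q` is `solidBlock s` in the layout from `off`, so h₇ takes its place among the
      -- blocks of G. The bound on `lim` puts the other six vertices before all of them.
      assemble : ∀ {q lim} off → odd off ≡ false → off + 2 * suc (suc r) ≤ M → q ≡ off + 2 * suc s → lim ≤ suc off →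
        HlCopy q lim → Contains adj (RightPseudogalaxy adjG s)
      assemble {q} {lim} off off-even room refl lim≤ hc = contains tT f respects
        where
        module C = HlCopy hc
        open Layout off off-even
        base : List Chosen
        base = map (λ i → C.σ i , C.x i) (allFin 7)
        open Place b b-anti b-irr {X} {M} {N} {L} {D}
        part : _
        part = galaxy-copy host off off-even room (s≤s (≤-trans (n≤1+n r) (n≤1+n (suc r)))) (*-monoˡ-≤ (2 ^ r) (≤ᵇ⇒≤ 2 8 _))
                 base (All.map⁺ (All.tabulate λ {i} _ → C.placed i)) ≤-refl (C.x 0F)
        module G = Partial part
        done : ∀ u → toℕ (cen u) < r
        done u = Fin.toℕ<n (cen u)
        f : Fin 7 ⊎ Fin r → V
        f (inj₁ i) = C.x i
        f (inj₂ u) = G.y u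
        clears : ∀ i u → Clears (proj₁ (slot u)) (G.y u) (C.σ i , C.x i)
        clears i u = All.lookup (G.cleared u (done u)) (∈-map⁺ (λ i → C.σ i , C.x i) (∈-allFin i))
        h-before-g : ∀ {i} → i ≢ 6F → ∀ u → C.x i ⟶ G.y u
        h-before-g {i} n u = proj₁ (clears i u) (<-≤-trans (C.early i n) (≤-trans lim≤ (slot-above u)))
        h₇-g : ∀ u → (s < π u → C.x 6F ⟶ G.y u) × (π u < s → G.y u ⟶ C.x 6F)
        h₇-g u = (λ l → proj₁ (clears 6F u) (≤-<-trans (≤-reflexive C.last) (proj₂ (slot-h₇ u) l)))
               , (λ l → proj₂ (clears 6F u) (<-≤-trans (proj₁ (slot-h₇ u) l) (≤-reflexive (sym C.last))))
        respects : Respects tT f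
        respects (inj₁ i) (inj₁ j) l = result (HlBack? j i) (C.copy i j (ρ₁-reflects l))
          where
          result : (d : Dec (HlBack j i)) → Oriented (not (does d)) (C.x i) (C.x j) →
            (PB (inj₁ j) (inj₁ i) × adj (C.x j) (C.x i)) ⊎ (¬ PB (inj₁ j) (inj₁ i) × adj (C.x i) (C.x j))
          result (yes p) e = inj₁ ((inj₂ (ρ₁-reflects l , p) , l) , b-true e)
          result (no n) e = inj₂ ((λ { (inj₁ (gt , _) , _) → <-asym gt (ρ₁-reflects l) ; (inj₂ (_ , p) , _) → n p }) , b-true e)
        respects (inj₁ i) (inj₂ u) l with i Fin.≟ 6F
        ... | yes refl = inj₂ ((λ ()) , b-true (proj₁ (h₇-g u) (+-cancelˡ-< 7 _ _ (subst (7 + s <_) (ρ₂-π u) l))))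
        ... | no n = inj₂ ((λ ()) , b-true (h-before-g n u))
        respects (inj₂ u) (inj₁ i) l with i Fin.≟ 6F
        ... | yes refl = inj₂ ((λ ()) , b-true (proj₂ (h₇-g u) (+-cancelˡ-< 7 _ _ (subst (_< 7 + s) (ρ₂-π u) l))))
        ... | no n = ⊥-elim (<-asym l (ρ₁<ρ₂ n u))
        respects (inj₂ u) (inj₂ w) l = result (adj? u w) (G.related u w (done u) (done w) u<w)
          where
          u<w : toℕ u < toℕ w
          u<w = π-reflects (+-cancelˡ-< 7 _ _ (subst₂ _<_ (ρ₂-π u) (ρ₂-π w) l))
          result : (d : Dec (adjG u w)) → Oriented (does d) (G.y u) (G.y w) →
            (PB (inj₂ w) (inj₂ u) × adj (G.y w) (G.y u)) ⊎ (¬ PB (inj₂ w) (inj₂ u) × adj (G.y u) (G.y w))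
          result (yes p) e = inj₂ ((λ (p' , _) → proj₂ (proj₂ tG) u w p p') , b-true e)
          result (no n) e = inj₁ ((back-edge , l) , b-true e)
            where
            back-edge : adjG w u
            back-edge with proj₁ (proj₂ tG) u w (λ { refl → <-irrefl refl u<w })
            ... | inj₁ p = ⊥-elim (n p)
            ... | inj₂ p = p

      host-contains : Contains adj (RightPseudogalaxy adjG s)
      host-contains = [ (λ hc → assemble off₁ refl (m≤m+n off₂ _) refl ≤-refl hc) , (λ hc → assemble off₂ off₂-even ≤-refl refl (s≤s (<⇒≤ q₁<off₂)) hc) ]′
        (hl-copy {q₁} {q₂} 12<q₁ q₁<q₂ q₂<M (s≤s (s≤s (s≤s z≤n))) (≤-trans (≤ᵇ⇒≤ 5 7 _) (m≤m+n 7 r))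
                           (≤-trans (≤-reflexive (sym (*-identityʳ 8))) (*-monoʳ-≤ 8 (m^n>0 2 r))) (odd-2* 12 (suc s) refl) (odd-2* off₂ (suc s) off₂-even))
        where
        q₁ = off₁ + 2 * suc s
        q₂ = off₂ + 2 * suc s
        off₂-even : odd off₂ ≡ false
        off₂-even = odd-2* 12 (suc (suc r)) refl
        12<q₁ : 12 < q₁
        12<q₁ = m<m+n 12 (s≤s z≤n)
        q₁<off₂ : q₁ < off₂
        q₁<off₂ = +-monoʳ-< 12 (*-monoʳ-< 2 (s≤s (s≤s s≤r)))
        q₁<q₂ : q₁ < q₂
        q₁<q₂ = <-≤-trans q₁<off₂ (m≤m+n off₂ _)
        q₂<M : q₂ < M
        q₂<M = +-monoʳ-< off₂ (*-monoʳ-< 2 (s≤s (s≤s s≤r)))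

-- From chains to transitive subtournaments and the conclusion

increasing : ∀ m (w : Fin (suc m) → ℕ) → (∀ i → w (inject₁ i) < w (F.suc i)) → w F.zero ≤ w (fromℕ m)
increasing zero w h = ≤-refl
increasing (suc m) w h = ≤-trans (<⇒≤ (h F.zero)) (increasing m (w ∘ F.suc) (h ∘ F.suc))

chain-transitive : ∀ {n} {adj : Fin n → Fin n → Set} → IsTournament adj → (ys : List (Fin n)) → AllPairs adj ys →
  HasTransitiveSub adj (length ys)
chain-transitive {n} {adj} (irr , _ , asym) ys ap = lookup ys , injective , acyclic
  where
  edge : ∀ {i j} → toℕ i < toℕ j → adj (lookup ys i) (lookup ys j)
  edge = AllPairs-tabulate⁻ (subst (AllPairs adj) (sym (tabulate-lookup ys)) ap)
  injective : Injective _≡_ _≡_ (lookup ys)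
  injective {i} {j} e with <-cmp (toℕ i) (toℕ j)
  ... | tri< l _ _ = ⊥-elim (irr _ (subst (adj (lookup ys i)) (sym e) (edge l)))
  ... | tri≈ _ p _ = Fin.toℕ-injective p
  ... | tri> _ _ l = ⊥-elim (irr _ (subst (adj (lookup ys j)) e (edge l)))
  edge⁻ : ∀ {i j} → adj (lookup ys i) (lookup ys j) → toℕ i < toℕ j
  edge⁻ {i} {j} a with <-cmp (toℕ i) (toℕ j)
  ... | tri< l _ _ = l
  ... | tri≈ _ p _ = ⊥-elim (irr _ (subst (λ k → adj (lookup ys i) (lookup ys k)) (sym (Fin.toℕ-injective p)) a))
  ... | tri> _ _ l = ⊥-elim (asym _ _ a (edge l))
  -- Indices in the list increase along every edge, so a directed walk cannot return to its start.
  acyclic : IsTransitive (λ i j → adj (lookup ys i) (lookup ys j))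
  acyclic (m , w , _ , steps , closing) = <⇒≱ (edge⁻ closing) (increasing m (toℕ ∘ w) (λ i → edge⁻ (steps i)))

theorem15 : (r : ℕ) (adjG : Fin r → Fin r → Set) → IsTournament adjG →
    (g : GalaxyOrdering adjG) → (s : ℕ) → 1 ≤ s → s ≤ r → SplitOK g s →
    Σ ℕ λ p → Σ ℕ λ q → 1 ≤ p × 1 ≤ q ×
    ((n : ℕ) (adjT : Fin n → Fin n → Set) → IsTournament adjT →
    ¬ Contains adjT (RightPseudogalaxy adjG s) →
    Σ ℕ λ k → HasTransitiveSub adjT k × k ^ q ≥ n ^ p)
theorem15 r adjG tG g s _ s≤r split = 1 , q , ≤-refl , exponent-pos , bound
  where
  open Pseudogalaxy tG g s split
  N≥1 : 1 ≤ N
  N≥1 = s≤s z≤n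
  D≥1 : 1 ≤ D
  D≥1 = *-mono-≤ {1} {8} (s≤s z≤n) (m^n>0 2 r)
  -- The exponent of the theorem is 1/q; all arguments of `exponent` are functions of r alone.
  q : ℕ
  q = exponent h M N E D
  exponent-pos : 1 ≤ q
  exponent-pos = exponent≥1 {h} (s≤s z≤n) M E N≥1 D≥1
  bound : (n : ℕ) (adjT : Fin n → Fin n → Set) → IsTournament adjT → ¬ Contains adjT (RightPseudogalaxy adjG s) →
    Σ ℕ λ k → HasTransitiveSub adjT k × k ^ q ≥ n ^ 1
  bound n adjT tT free = length (proj₁ goal) , chain-transitive tT (proj₁ goal) (AllPairs.map b-true (proj₂ (proj₁ (proj₂ goal)))) , large
    where
    open AsBool Fin._≟_ tT
    open InTournament Fin._≟_ tT
    open Critical b b-anti b-irr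
    goal : Goal q (allFin n)
    goal = erdős-hajnal h H H-anti (s≤s z≤n) (free ∘ copy-contains) odd M N E D N≥1 D≥1 (λ X host → free (host-contains s≤r host)) (allFin n) (Unique.allFin⁺ n)
    large : length (proj₁ goal) ^ q ≥ n ^ 1
    large = ≤-trans (≤-reflexive (trans (^-identityʳ n) (sym (length-tabulate (λ (i : Fin n) → i))))) (proj₂ (proj₂ goal))
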